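{- Let $d\geq 2$ be an integer and let $G$ be a $d$-regular (finite, simple) graph on $n$ vertices. Then the number $F(G)$ of spanning forests of $G$ satisfies $F(G)\leq d^n$.
   Context: A spanning forest of $G$ is an acyclic subset $A\subseteq E(G)$ of edges (considered as a graph on the full vertex set $V(G)$); $F(G)$ denotes the number of such edge sets, including the empty set. -}

module Defs where

open import Data.Nat using (ℕ; zero; suc)
open import Data.Bool using (Bool; true; false)
open import Data.Fin using (Fin; zero; suc; inject₁; fromℕ)
open import Data.List using (length; filter)
open import Data.List using (List)
open import Data.Fin using () renaming (_≟_ to _≟ᶠ_)
open import Data.List.Base using ()
open import Data.Fin.Base using ()
open import Data.List using () renaming (map to lmap)
open import Data.Product using (Σ; ∃; _×_; _,_)
open import Data.Empty using (⊥)
open import Relation.Nullary using (¬_)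
open import Relation.Binary.PropositionalEquality using (_≡_; _≢_)
open import Function.Definitions using (Injective)
open import Data.List using () renaming (allFin to allFinL)
open import Data.Bool using () renaming (_≟_ to _≟ᵇ_)

record SimpleGraph (n : ℕ) : Set where
  field
    adj      : Fin n → Fin n → Bool
    symm     : ∀ i j → adj i j ≡ adj j i
    irrefl   : ∀ i → adj i i ≡ false
open SimpleGraph public

degree : ∀ {n} → SimpleGraph n → Fin n → ℕ
degree {n} G i = length (filter (λ j → adj G i j ≟ᵇ true) (allFinL n))

Regular : ∀ {n} → ℕ → SimpleGraph n → Set
Regular d G = ∀ i → degree G i ≡ d

-- A set of edges of G: a symmetric Boolean relation contained in adj G
-- (irreflexivity follows from containment).
record EdgeSet {n : ℕ} (G : SimpleGraph n) : Set where
  field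
    mem    : Fin n → Fin n → Bool
    msymm  : ∀ i j → mem i j ≡ mem j i
    sub    : ∀ i j → mem i j ≡ true → adj G i j ≡ true
open EdgeSet public

SameEdges : ∀ {n} {G : SimpleGraph n} → EdgeSet G → EdgeSet G → Set
SameEdges A B = ∀ i j → mem A i j ≡ mem B i j

record Cycle {n : ℕ} {G : SimpleGraph n} (A : EdgeSet G) : Set where
  field
    m      : ℕ
    v      : Fin (suc (suc (suc m))) → Fin n
    v-inj  : Injective _≡_ _≡_ v
    step   : ∀ (i : Fin (suc (suc m))) → mem A (v (inject₁ i)) (v (suc i)) ≡ true
    close  : mem A (v (fromℕ (suc (suc m)))) (v zero) ≡ true

Acyclic : ∀ {n} {G : SimpleGraph n} → EdgeSet G → Set
Acyclic A = ¬ Cycle A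

SpanningForest : ∀ {n} → SimpleGraph n → Set
SpanningForest G = Σ (EdgeSet G) Acyclic

-- "F(G) ≤ N": every family of k pairwise distinct spanning forests has k ≤ N.
-- (F(G) is the number of spanning forests; this is exactly F(G) ≤ N.)
open import Data.Nat using (_≤_)
open import Data.Product using (proj₁)
FCountAtMost : ∀ {n} → SimpleGraph n → ℕ → Set
FCountAtMost G N =
  ∀ (k : ℕ) (f : Fin k → SpanningForest G) →
    (∀ i j → SameEdges (proj₁ (f i)) (proj₁ (f j)) → i ≡ j) →
    k ≤ N

{-# OPTIONS --safe #-}
module Submission where

-- For a set S of vertices let N(S) be the number of forests of the graph in which S and one extra
-- isolated vertex have been contracted to a point, and put a = d + 1.  Deleting and contracting the edges one by one,
-- those at a vertex v ∉ S last, gives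
--   N(S) + 2 Σ N(S + v + u) ≤ a N(S + v),     u ranging over the neighbours of v outside S.
-- So the ratios r_v = N(S) / N(S + v) satisfy r_v ≤ a − 2 Σ 1/r_u, and hence also r_u ≤ a − 2k/a
-- when u has k neighbours outside S.  Substituting the second bound into the first, one finds a
-- function g with g(0) = a and g(d) = d such that N(S) ≤ ∏_{v ∉ S} g(number of neighbours of v
-- outside S), by induction on the complement of S.  At S = ∅ this is F(G) ≤ dⁿ.
-- Such a g exists for d ≥ 5; for d ≤ 4 the number 2^(nd/2) of all edge sets is at most dⁿ.

open import Defs
open import Data.Bool using (Bool; true; false; if_then_else_) renaming (_≟_ to _≟ᵇ_)
open import Data.Empty using (⊥; ⊥-elim)
open import Data.Fin using (Fin; zero; suc; _≟_; inject₁; fromℕ)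
open import Data.Fin.Properties using (suc-injective)
open import Data.List using (List; []; _∷_; _++_; length; map; filter; allFin; lookup)
open import Data.List.Properties using (filter-++; filter-accept; filter-reject; length-++; length-map; length-tabulate; map-++; ++-identityʳ)
open import Data.List.Membership.Propositional using (_∈_; _∉_)
open import Data.List.Membership.Propositional.Properties using (∈-∃++; ∈-filter⁻; ∈-filter⁺; ∈-allFin; ∈-++⁺ˡ; ∈-++⁺ʳ; ∈-map⁺; ∈-lookup)
open import Data.List.Relation.Binary.Permutation.Propositional using (_↭_; refl; prep; swap; trans; ↭-sym; ↭-trans; ↭⇒↭ₛ; ↭-reflexive)
open import Data.List.Relation.Binary.Permutation.Propositional.Properties using (++-comm; ++⁺ʳ; map⁺; filter-↭; shift; shifts; ↭-length; ∈-resp-↭)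
open import Data.List.Relation.Binary.Permutation.Setoid.Properties using (Unique-resp-↭)
open import Data.List.Relation.Binary.Subset.Propositional using (_⊆_)
open import Data.List.Relation.Unary.All as All using (All; []; _∷_)
import Data.List.Relation.Unary.All.Properties as All
open import Data.List.Relation.Unary.AllPairs as AllPairs using (AllPairs; []; _∷_)
import Data.List.Relation.Unary.AllPairs.Properties as AllPairs
open import Data.List.Relation.Unary.Any using (here; there)
open import Data.List.Relation.Unary.Unique.Propositional using (Unique)
open import Data.List.Relation.Unary.Unique.Propositional.Properties using (allFin⁺) renaming (filter⁺ to unique-filter⁺)
open import Data.Nat using (ℕ; zero; suc; _+_; _*_; _∸_; _^_; _≤_; _<_; _≤?_; z≤n; s≤s; >-nonZero)
open import Data.Nat.ListAction using (sum; product)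
open import Data.Nat.Properties hiding (_≟_; suc-injective; _≤?_)
open import Data.Nat.Solver using (module +-*-Solver)
open import Data.Product using (_×_; _,_; proj₁; proj₂; ∃; ∃₂)
open import Data.Sum using (_⊎_; inj₁; inj₂)
open import Data.Unit using (⊤; tt)
open import Function using (_∘_; case_of_)
open import Relation.Binary.Construct.Closure.ReflexiveTransitive as Walk using (ε; _◅_; _◅◅_) renaming (Star to Walk)
open import Relation.Binary.PropositionalEquality as Eq using (_≡_; _≢_; cong; cong₂; subst; module ≡-Reasoning)
open import Relation.Nullary using (¬_; Dec; does; yes; no)
open import Relation.Nullary.Decidable using (from-yes)
open +-*-Solver using (solve; _:+_; _:*_; con; _:=_)

-- Without its sum the inequality says r_v ≤ d + 1 and yields only (d + 1)^n. The saving comes from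
-- unwired neighbours, and the last vertex to be wired has none: there r_v = d + 1. So no bound by d
-- holds vertex by vertex, and the product of the g's serves as a potential that moves savings
-- between neighbours. Wiring v removes its factor g(k) and lowers the argument at each unwired
-- neighbour u from y_u + 1 to y_u, so the induction needs r_v ≤ g(k) ∏ g(y_u + 1) / g(y_u). As g(0)
-- = a, writing g(k) / g(0) as a telescoping product pairs the m-th neighbour with g(m + 1) / g(m),
-- and one inequality for each pair (m, y_u), symmetric in the two, suffices. The extra isolated
-- vertex gives the first wired vertex something to be contracted to. The recursion that counts
-- forests fixes an order of the edges, whereas the edges at v must come last for every v in turn;
-- hence the count has to be shown independent of that order.

private variable
  n : ℕ

-- Partitions of the vertices and their refinement order.

Edge : ℕ → Set
Edge n = Fin n × Fin n

-- A labelling stands for the partition of the vertices into its fibres.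
Labelling : ℕ → Set
Labelling n = Fin n → Fin n

infix 4 _≼_

record _≼_ (π ρ : Labelling n) : Set where
  constructor coarser
  field
    related : ∀ {x y} → π x ≡ π y → ρ x ≡ ρ y

open _≼_

-- Contraction of the edge xy. The class of x takes over the label of y, so merges in different
-- orders agree only as partitions, that is, up to `≼` in both directions.
merge : Labelling n → Fin n → Fin n → Labelling n
merge π x y w = if does (π w ≟ π x) then π y else π w

≼-trans : {π ρ σ : Labelling n} → π ≼ ρ → ρ ≼ σ → π ≼ σ
≼-trans p q = coarser (λ e → related q (related p e))

≼-merge : (π : Labelling n) (x y : Fin n) → π ≼ merge π x y
≼-merge π x y = coarser joined
  where
  joined : ∀ {u w} → π u ≡ π w → merge π x y u ≡ merge π x y w
  joined {u} {w} e with π u ≟ π x | π w ≟ π x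
  ... | yes _ | yes _ = Eq.refl
  ... | no _  | no _  = e
  ... | yes p | no ¬q = ⊥-elim (¬q (Eq.trans (Eq.sym e) p))
  ... | no ¬p | yes q = ⊥-elim (¬p (Eq.trans e q))

merge-joins : (π : Labelling n) (x y : Fin n) → merge π x y x ≡ merge π x y y
merge-joins π x y with π x ≟ π x | π y ≟ π x
... | yes _ | yes _ = Eq.refl
... | yes _ | no _  = Eq.refl
... | no ¬p | _     = ⊥-elim (¬p Eq.refl)

merge-related : (π : Labelling n) (x y : Fin n) {u w : Fin n} → merge π x y u ≡ merge π x y w →
  π u ≡ π w ⊎ (π u ≡ π x × π w ≡ π y) ⊎ (π u ≡ π y × π w ≡ π x)
merge-related π x y {u} {w} e with π u ≟ π x | π w ≟ π x
... | yes p | yes q = inj₁ (Eq.trans p (Eq.sym q))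
... | yes p | no _  = inj₂ (inj₁ (p , Eq.sym e))
... | no _  | yes q = inj₂ (inj₂ (e , q))
... | no _  | no _  = inj₁ e

merge-least : {π ρ : Labelling n} {x y : Fin n} → π ≼ ρ → ρ x ≡ ρ y → merge π x y ≼ ρ
merge-least {π = π} {ρ} {x} {y} le e = coarser joined
  where
  joined : ∀ {u w} → merge π x y u ≡ merge π x y w → ρ u ≡ ρ w
  joined m with merge-related π x y m
  ... | inj₁ p              = related le p
  ... | inj₂ (inj₁ (p , q)) = Eq.trans (related le p) (Eq.trans e (Eq.sym (related le q)))
  ... | inj₂ (inj₂ (p , q)) = Eq.trans (related le p) (Eq.trans (Eq.sym e) (Eq.sym (related le q)))

merge-mono : {π ρ : Labelling n} {x y : Fin n} → π ≼ ρ → merge π x y ≼ merge ρ x y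
merge-mono {ρ = ρ} {x} {y} le =
  merge-least (≼-trans le (≼-merge ρ x y)) (merge-joins ρ x y)

merge-comm : (π : Labelling n) (x y u w : Fin n) →
  merge (merge π x y) u w ≼ merge (merge π u w) x y
merge-comm π x y u w =
  merge-least
    (merge-least (≼-trans (≼-merge π u w) (≼-merge (merge π u w) x y)) (merge-joins (merge π u w) x y))
    (related (≼-merge (merge π u w) x y) (merge-joins π u w))

-- Counting forests by deletion and contraction.

-- The number of sublists of es that are acyclic once every fibre of π is contracted.
forests : List (Edge n) → Labelling n → ℕ
forests []             π = 1
forests ((x , y) ∷ es) π =
  forests es π + (if does (π x ≟ π y) then 0 else forests es (merge π x y))

-- The number of those acyclic sublists of e ∷ es that use e.
through : List (Edge n) → Edge n → Labelling n → ℕ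
through es (x , y) π = if does (π x ≟ π y) then 0 else forests es (merge π x y)

throughBoth : List (Edge n) → Edge n → Edge n → Labelling n → ℕ
throughBoth es (x , y) f π = if does (π x ≟ π y) then 0 else through es f (merge π x y)

module _ (π : Labelling n) {x y : Fin n} where

  through-loop : ∀ es → π x ≡ π y → through es (x , y) π ≡ 0
  through-loop es e with π x ≟ π y
  ... | yes _ = Eq.refl
  ... | no ¬e = ⊥-elim (¬e e)

  through-nonloop : ∀ es → π x ≢ π y → through es (x , y) π ≡ forests es (merge π x y)
  through-nonloop es ¬e with π x ≟ π y
  ... | yes e = ⊥-elim (¬e e)
  ... | no _  = Eq.refl

  throughBoth-loop : ∀ es f → π x ≡ π y → throughBoth es (x , y) f π ≡ 0
  throughBoth-loop es f e with π x ≟ π y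
  ... | yes _ = Eq.refl
  ... | no ¬e = ⊥-elim (¬e e)

  throughBoth-nonloop : ∀ es f → π x ≢ π y → throughBoth es (x , y) f π ≡ through es f (merge π x y)
  throughBoth-nonloop es f ¬e with π x ≟ π y
  ... | yes e = ⊥-elim (¬e e)
  ... | no _  = Eq.refl

-- Coarsening a partition only creates loops: an edge that may be contracted in the coarser one may
-- be contracted in the finer one as well.
forests-antitone : ∀ es {π ρ : Labelling n} → π ≼ ρ → forests es ρ ≤ forests es π
through-antitone : ∀ es e {π ρ : Labelling n} → π ≼ ρ → through es e ρ ≤ through es e π

forests-antitone []       le = ≤-refl
forests-antitone (e ∷ es) le = +-mono-≤ (forests-antitone es le) (through-antitone es e le)

through-antitone es (x , y) {π} {ρ} le with ρ x ≟ ρ y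
... | yes _ = z≤n
... | no ¬e with π x ≟ π y
...   | yes e = ⊥-elim (¬e (related le e))
...   | no _  = forests-antitone es (merge-mono {x = x} {y} le)

forests-cong : ∀ es {π ρ : Labelling n} → π ≼ ρ → ρ ≼ π → forests es π ≡ forests es ρ
forests-cong es p q = ≤-antisym (forests-antitone es q) (forests-antitone es p)

through-cong : ∀ es e {π ρ : Labelling n} → π ≼ ρ → ρ ≼ π → through es e π ≡ through es e ρ
through-cong es e p q = ≤-antisym (through-antitone es e q) (through-antitone es e p)

-- If contracting xy turns the non-loop uw into a loop, the two edges join the same two classes;
-- being parallel, each makes a loop of the other.
loop-exchange : (π : Labelling n) {x y u w : Fin n} → π u ≢ π w →
  merge π x y u ≡ merge π x y w → merge π u w x ≡ merge π u w y
loop-exchange π {x} {y} {u} {w} ¬l e with merge-related π x y e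
... | inj₁ l = ⊥-elim (¬l l)
... | inj₂ (inj₁ (p , q)) =
  Eq.trans (related (≼-merge π u w) (Eq.sym p))
    (Eq.trans (merge-joins π u w) (related (≼-merge π u w) q))
... | inj₂ (inj₂ (p , q)) =
  Eq.trans (related (≼-merge π u w) (Eq.sym q))
    (Eq.trans (Eq.sym (merge-joins π u w)) (related (≼-merge π u w) p))

throughBoth-comm : ∀ es e f (π : Labelling n) → throughBoth es e f π ≡ throughBoth es f e π
throughBoth-comm es (x , y) (u , w) π with π x ≟ π y | π u ≟ π w
... | yes _ | yes _ = Eq.refl
... | yes e | no _  = Eq.sym (through-loop (merge π u w) es (related (≼-merge π u w) e))
... | no _  | yes f = through-loop (merge π x y) es (related (≼-merge π x y) f)
... | no ¬e | no ¬f with merge π x y u ≟ merge π x y w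
...   | yes l = Eq.sym (through-loop (merge π u w) es (loop-exchange π ¬f l))
...   | no ¬l =
  Eq.trans (forests-cong es (merge-comm π x y u w) (merge-comm π u w x y))
    (Eq.sym (through-nonloop (merge π u w) es (λ l → ¬l (loop-exchange π ¬e l))))

through-∷ : ∀ f es e (π : Labelling n) → through (f ∷ es) e π ≡ through es e π + throughBoth es f e π
through-∷ f es e π = Eq.trans (step e) (cong (through es e π +_) (throughBoth-comm es e f π))
  where
  step : ∀ e → through (f ∷ es) e π ≡ through es e π + throughBoth es e f π
  step (x , y) with π x ≟ π y
  ... | yes _ = Eq.refl
  ... | no _  = Eq.refl

-- Independence of the order and orientation of the edges.

infix 4 _≅_

record _≅_ (es fs : List (Edge n)) : Set where
  constructor equinumerous
  field
    forests-≡ : ∀ π → forests es π ≡ forests fs π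

open _≅_

≅-trans : {es fs gs : List (Edge n)} → es ≅ fs → fs ≅ gs → es ≅ gs
≅-trans p q = equinumerous λ π → Eq.trans (forests-≡ p π) (forests-≡ q π)

through-≅ : {es fs : List (Edge n)} → es ≅ fs → ∀ e π → through es e π ≡ through fs e π
through-≅ p (x , y) π with π x ≟ π y
... | yes _ = Eq.refl
... | no _  = forests-≡ p (merge π x y)

∷-≅ : {es fs : List (Edge n)} (e : Edge n) → es ≅ fs → e ∷ es ≅ e ∷ fs
∷-≅ e p = equinumerous λ π → cong₂ _+_ (forests-≡ p π) (through-≅ p e π)

++-≅ : {es fs : List (Edge n)} (gs : List (Edge n)) → es ≅ fs → gs ++ es ≅ gs ++ fs
++-≅ []       p = p
++-≅ (g ∷ gs) p = ∷-≅ g (++-≅ gs p)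

swap-≅ : (e f : Edge n) (es : List (Edge n)) → e ∷ f ∷ es ≅ f ∷ e ∷ es
swap-≅ e f es = equinumerous λ π → begin
  forests es π + through es f π + through (f ∷ es) e π
    ≡⟨ cong (forests es π + through es f π +_) (through-∷ f es e π) ⟩
  forests es π + through es f π + (through es e π + throughBoth es f e π)
    ≡⟨ cong (λ t → forests es π + through es f π + (through es e π + t)) (throughBoth-comm es f e π) ⟩
  forests es π + through es f π + (through es e π + throughBoth es e f π)
    ≡⟨ solve 4 (λ a b c d → a :+ b :+ (c :+ d) := a :+ c :+ (b :+ d)) Eq.refl
         (forests es π) (through es f π) (through es e π) (throughBoth es e f π) ⟩
  forests es π + through es e π + (through es f π + throughBoth es e f π)
    ≡⟨ cong (forests es π + through es e π +_) (Eq.sym (through-∷ e es f π)) ⟩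
  forests es π + through es e π + through (e ∷ es) f π ∎
  where open ≡-Reasoning

↭⇒≅ : {es fs : List (Edge n)} → es ↭ fs → es ≅ fs
↭⇒≅ refl         = equinumerous λ π → Eq.refl
↭⇒≅ (prep e p)   = ∷-≅ e (↭⇒≅ p)
↭⇒≅ (swap {xs = es} e f p) = ≅-trans (swap-≅ e f es) (∷-≅ f (∷-≅ e (↭⇒≅ p)))
↭⇒≅ (trans p q)  = ≅-trans (↭⇒≅ p) (↭⇒≅ q)

flip-≅ : (x y : Fin n) (es : List (Edge n)) → (x , y) ∷ es ≅ (y , x) ∷ es
flip-≅ x y es = equinumerous λ π → cong (forests es π +_) (flip π)
  where
  flip : ∀ π → through es (x , y) π ≡ through es (y , x) π
  flip π with π x ≟ π y | π y ≟ π x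
  ... | yes _ | yes _ = Eq.refl
  ... | yes e | no ¬e = ⊥-elim (¬e (Eq.sym e))
  ... | no ¬e | yes e = ⊥-elim (¬e (Eq.sym e))
  ... | no _  | no _  =
    forests-cong es
      (merge-least (≼-merge π y x) (Eq.sym (merge-joins π y x)))
      (merge-least (≼-merge π x y) (Eq.sym (merge-joins π x y)))

forests-≤-2^ : ∀ es (π : Labelling n) → forests es π ≤ 2 ^ length es
forests-≤-2^ []             π = ≤-refl
forests-≤-2^ ((x , y) ∷ es) π = +-mono-≤ (forests-≤-2^ es π) (bound (x , y))
  where
  bound : ∀ e → through es e π ≤ 2 ^ length es + 0
  bound (x , y) rewrite +-identityʳ (2 ^ length es) with π x ≟ π y
  ... | yes _ = z≤n
  ... | no _  = forests-≤-2^ es (merge π x y)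

-- Wiring a vertex

star : Fin n → List (Fin n) → List (Edge n)
star v us = map (v ,_) us

-- Each vu is contracted on top of all of `es`, whose own copy of vu then becomes a loop. Once v is
-- wired in `π`, the term for u is therefore N(S + v + u), the whole graph with u wired too.
throughs : List (Edge n) → Fin n → List (Fin n) → Labelling n → ℕ
throughs es v us π = sum (map (λ u → through es (v , u) π) us)

through-∷-loop : ∀ {x y} es e (π : Labelling n) → π x ≡ π y →
  through ((x , y) ∷ es) e π ≡ through es e π
through-∷-loop {x = x} {y} es e π l = begin
  through ((x , y) ∷ es) e π                     ≡⟨ through-∷ (x , y) es e π ⟩
  through es e π + throughBoth es (x , y) e π    ≡⟨ cong (through es e π +_) (throughBoth-loop π es e l) ⟩
  through es e π + 0                             ≡⟨ +-identityʳ _ ⟩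
  through es e π                                 ∎
  where open ≡-Reasoning

through-∷-nonloop : ∀ {x y} es e (π : Labelling n) → π x ≢ π y →
  through ((x , y) ∷ es) e π ≡ through es e π + through es e (merge π x y)
through-∷-nonloop es e π ¬l =
  Eq.trans (through-∷ _ es e π) (cong (through es e π +_) (throughBoth-nonloop π es e ¬l))

throughs-∷-loop : ∀ {x y} es v us (π : Labelling n) → π x ≡ π y →
  throughs ((x , y) ∷ es) v us π ≡ throughs es v us π
throughs-∷-loop es v []       π l = Eq.refl
throughs-∷-loop es v (u ∷ us) π l =
  cong₂ _+_ (through-∷-loop es (v , u) π l) (throughs-∷-loop es v us π l)

throughs-∷-nonloop : ∀ {x y} es v us (π : Labelling n) → π x ≢ π y →
  throughs ((x , y) ∷ es) v us π ≡ throughs es v us π + throughs es v us (merge π x y)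
throughs-∷-nonloop             es v []       π ¬l = Eq.refl
throughs-∷-nonloop {x = x} {y} es v (u ∷ us) π ¬l =
  Eq.trans (cong₂ _+_ (through-∷-nonloop es (v , u) π ¬l) (throughs-∷-nonloop es v us π ¬l))
    (solve 4 (λ a b c d → a :+ b :+ (c :+ d) := a :+ c :+ (b :+ d)) Eq.refl
      (through es (v , u) π) (through es (v , u) (merge π x y))
      (throughs es v us π) (throughs es v us (merge π x y)))

throughs-cong : ∀ es v us {π ρ : Labelling n} → π ≼ ρ → ρ ≼ π → throughs es v us π ≡ throughs es v us ρ
throughs-cong es v []       p q = Eq.refl
throughs-cong es v (u ∷ us) p q = cong₂ _+_ (through-cong es (v , u) p q) (throughs-cong es v us p q)

throughs-≅ : ∀ {es fs} → es ≅ fs → ∀ v us (π : Labelling n) → throughs es v us π ≡ throughs fs v us π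
throughs-≅ p v []       π = Eq.refl
throughs-≅ p v (u ∷ us) π = cong₂ _+_ (through-≅ p (v , u) π) (throughs-≅ p v us π)

-- Splits a bound on F + 2T ≤ c R along the two branches of the deletion–contraction recursion.
split-bound : ∀ {F F₁ F₂ T T₁ T₂ R R₁ R₂ : ℕ} c → F ≡ F₁ + F₂ → T ≡ T₁ + T₂ → R ≡ R₁ + R₂ →
  F₁ + 2 * T₁ ≤ c * R₁ → F₂ + 2 * T₂ ≤ c * R₂ → F + 2 * T ≤ c * R
split-bound {F₁ = F₁} {F₂} {T₁ = T₁} {T₂} {R₁ = R₁} {R₂} c Eq.refl Eq.refl Eq.refl p q = begin
  F₁ + F₂ + 2 * (T₁ + T₂)
    ≡⟨ solve 4 (λ a b s t → a :+ b :+ con 2 :* (s :+ t) := a :+ con 2 :* s :+ (b :+ con 2 :* t))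
         Eq.refl F₁ F₂ T₁ T₂ ⟩
  F₁ + 2 * T₁ + (F₂ + 2 * T₂)   ≤⟨ +-mono-≤ p q ⟩
  c * R₁ + c * R₂               ≡⟨ *-distribˡ-+ c R₁ R₂ ⟨
  c * (R₁ + R₂)                 ∎
  where open ≤-Reasoning

-- If v, s and the k leaves have distinct labels, this is the equality 2^k + 2k 2^(k-1) = (k + 1)
-- 2^k. The induction shows that coinciding labels can only help.
star-bound : ∀ v s us (π : Labelling n) →
  forests (star v us) π + 2 * throughs (star v us) v us (merge π v s)
    ≤ suc (length us) * forests (star v us) (merge π v s)
star-bound v s []       π = ≤-refl
star-bound v s (x ∷ us) π = split (merge π v s v ≟ merge π v s x)
  where
  open ≤-Reasoning
  f = v , x
  k = suc (length us)
  es = star v us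
  ρ = merge π v s
  A = forests es π
  R = forests es ρ
  T = throughs es v us ρ
  t = through es f π

  split : Dec (ρ v ≡ ρ x) →
    forests (f ∷ es) π + 2 * throughs (f ∷ es) v (x ∷ us) ρ ≤ suc k * forests (f ∷ es) ρ
  -- The edge vx adds nothing to `T` or `R`; only its gain `t` is new. It is at most `R`, because x
  -- then lies in the class of s (or vx is a loop already), so contracting vx joins v to s as well.
  split (yes l) = begin
    A + t + 2 * throughs (f ∷ es) v (x ∷ us) ρ   ≡⟨ cong (λ z → A + t + 2 * z) T≡ ⟩
    A + t + 2 * T
      ≡⟨ solve 3 (λ a b s → a :+ b :+ con 2 :* s := b :+ (a :+ con 2 :* s)) Eq.refl A t T ⟩
    t + (A + 2 * T)                                  ≤⟨ +-mono-≤ t≤R (star-bound v s us π) ⟩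
    suc k * R                                        ≡⟨ cong (suc k *_) (+-identityʳ R) ⟨
    suc k * (R + 0)                                  ≡⟨ cong (λ z → suc k * (R + z)) (through-loop ρ es l) ⟨
    suc k * forests (f ∷ es) ρ                       ∎
    where
    T≡ : throughs (f ∷ es) v (x ∷ us) ρ ≡ T
    T≡ = cong₂ _+_ (through-loop ρ (f ∷ es) l) (throughs-∷-loop es v us ρ l)
    t≤R : t ≤ R
    t≤R with π v ≟ π x
    ... | yes _ = z≤n
    ... | no ¬e = forests-antitone es (merge-least (≼-merge π v x) joined)
      where
      joined : merge π v x v ≡ merge π v x s
      joined with merge-related π v s l
      ... | inj₁ e              = ⊥-elim (¬e e)
      ... | inj₂ (inj₁ (_ , q)) = Eq.trans (merge-joins π v x) (related (≼-merge π v x) q)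
      ... | inj₂ (inj₂ (_ , q)) = ⊥-elim (¬e (Eq.sym q))
  split (no ¬l) = begin
    A + t + 2 * throughs (f ∷ es) v (x ∷ us) ρ        ≡⟨ cong₂ (λ y z → A + y + 2 * z) t≡ T≡ ⟩
    A + A′ + 2 * (R′ + (T + T′))
      ≡⟨ solve 5 (λ a a′ r t t′ → a :+ a′ :+ con 2 :* (r :+ (t :+ t′))
                    := (a :+ con 2 :* t) :+ (a′ :+ con 2 :* t′) :+ con 2 :* r) Eq.refl A A′ R′ T T′ ⟩
    (A + 2 * T) + (A′ + 2 * T′) + 2 * R′
      -- The coefficient grows by one, which allows an extra R + R′; the new term 2 R′ fits because
      -- R′ ≤ R.
      ≤⟨ +-mono-≤ (+-mono-≤ (star-bound v s us π) ih′) (+-monoˡ-≤ (R′ + 0) R′≤R) ⟩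
    k * R + k * R′ + (R + (R′ + 0))
      ≡⟨ solve 3 (λ k r r′ → k :* r :+ k :* r′ :+ (r :+ (r′ :+ con 0)) := (con 1 :+ k) :* (r :+ r′))
           Eq.refl k R R′ ⟩
    suc k * (R + R′)
      ≡⟨ cong (λ z → suc k * (R + z)) (through-nonloop ρ es ¬l) ⟨
    suc k * forests (f ∷ es) ρ                         ∎
    where
    A′ = forests es (merge π v x)
    R′ = forests es (merge ρ v x)
    T′ = throughs es v us (merge ρ v x)
    t≡ : t ≡ A′
    t≡ = through-nonloop π es (λ e → ¬l (related (≼-merge π v s) e))
    T≡ : throughs (f ∷ es) v (x ∷ us) ρ ≡ R′ + (T + T′)
    T≡ = cong₂ _+_
      (Eq.trans (through-nonloop ρ (f ∷ es) ¬l)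
        (Eq.trans (cong (R′ +_) (through-loop (merge ρ v x) es (merge-joins ρ v x))) (+-identityʳ R′)))
      (throughs-∷-nonloop es v us ρ ¬l)
    R′≤R : R′ ≤ R
    R′≤R = forests-antitone es (≼-merge ρ v x)
    ih′ : A′ + 2 * T′ ≤ k * R′
    ih′ = begin
      A′ + 2 * T′
        ≡⟨ cong (λ z → A′ + 2 * z) (throughs-cong es v us (merge-comm π v s v x) (merge-comm π v x v s)) ⟩
      A′ + 2 * throughs es v us (merge (merge π v x) v s)
        ≤⟨ star-bound v s us (merge π v x) ⟩
      k * forests es (merge (merge π v x) v s)
        ≡⟨ cong (k *_) (forests-cong es (merge-comm π v x v s) (merge-comm π v s v x)) ⟩
      k * R′ ∎

-- Bounds the ratio r_v = forests π / forests (merge π v s) by 1 + deg v − 2 Σ 1/r_u, the sum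
-- running over the neighbours u of v not yet wired to s.
wiring-bound : ∀ v s us rest (π : Labelling n) →
  All (λ e → proj₁ e ≢ v × proj₂ e ≢ v) rest → (∀ w → π w ≡ π v → w ≡ v) →
  forests (rest ++ star v us) π + 2 * throughs (rest ++ star v us) v us (merge π v s)
    ≤ suc (length us) * forests (rest ++ star v us) (merge π v s)
wiring-bound v s us []               π avoid alone = star-bound v s us π
wiring-bound v s us ((x , y) ∷ rest) π ((x≢v , y≢v) ∷ avoid) alone = split (π x ≟ π y)
  where
  open ≤-Reasoning
  es = rest ++ star v us
  ρ = merge π v s
  k = suc (length us)

  split : Dec (π x ≡ π y) →
    forests ((x , y) ∷ es) π + 2 * throughs ((x , y) ∷ es) v us ρ ≤ k * forests ((x , y) ∷ es) ρ
  split (yes e) = begin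
    forests ((x , y) ∷ es) π + 2 * throughs ((x , y) ∷ es) v us ρ
      ≡⟨ cong₂ (λ a t → forests es π + a + 2 * t) (through-loop π es e) (throughs-∷-loop es v us ρ l) ⟩
    forests es π + 0 + 2 * throughs es v us ρ
      ≡⟨ cong (_+ 2 * throughs es v us ρ) (+-identityʳ (forests es π)) ⟩
    forests es π + 2 * throughs es v us ρ
      ≤⟨ wiring-bound v s us rest π avoid alone ⟩
    k * forests es ρ
      ≡⟨ cong (k *_) (+-identityʳ _) ⟨
    k * (forests es ρ + 0)
      ≡⟨ cong (λ z → k * (forests es ρ + z)) (through-loop ρ es l) ⟨
    k * forests ((x , y) ∷ es) ρ ∎
    where
    l : ρ x ≡ ρ y
    l = related (≼-merge π v s) e
  split (no ¬e) = split-bound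
      {F₁ = forests es π} {forests es (merge π x y)}
      {T₁ = throughs es v us ρ} {throughs es v us (merge ρ x y)} k
      (cong (forests es π +_) (through-nonloop π es ¬e))
      (throughs-∷-nonloop es v us ρ ¬l) (cong (forests es ρ +_) (through-nonloop ρ es ¬l))
      (wiring-bound v s us rest π avoid alone) contracted
    where
    -- Since v is alone in its class, wiring it enlarges the class of s by v only, and an edge
    -- avoiding v becomes a loop only if it was one. Thus `π` and `ρ` branch alike on every edge of
    -- `rest`.
    ¬l : ρ x ≢ ρ y
    ¬l l with merge-related π v s l
    ... | inj₁ p              = ¬e p
    ... | inj₂ (inj₁ (p , _)) = x≢v (alone x p)
    ... | inj₂ (inj₂ (_ , q)) = y≢v (alone y q)
    alone′ : ∀ w → merge π x y w ≡ merge π x y v → w ≡ v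
    alone′ w p with merge-related π x y p
    ... | inj₁ q              = alone w q
    ... | inj₂ (inj₁ (_ , q)) = ⊥-elim (y≢v (alone y (Eq.sym q)))
    ... | inj₂ (inj₂ (_ , q)) = ⊥-elim (x≢v (alone x (Eq.sym q)))
    contracted : forests es (merge π x y) + 2 * throughs es v us (merge ρ x y)
      ≤ k * forests es (merge ρ x y)
    contracted = begin
      forests es (merge π x y) + 2 * throughs es v us (merge ρ x y)
        ≡⟨ cong (λ t → forests es (merge π x y) + 2 * t)
             (throughs-cong es v us (merge-comm π v s x y) (merge-comm π x y v s)) ⟩
      forests es (merge π x y) + 2 * throughs es v us (merge (merge π x y) v s)
        ≤⟨ wiring-bound v s us rest (merge π x y) avoid alone′ ⟩
      k * forests es (merge (merge π x y) v s)
        ≡⟨ cong (k *_) (forests-cong es (merge-comm π x y v s) (merge-comm π v s x y)) ⟩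
      k * forests es (merge ρ x y) ∎

-- The numerical profile

EdgeInequality : ℕ → (ℕ → ℕ) → ℕ → ℕ → Set
EdgeInequality d G m y =
  (s ∸ 2 * m) * (s ∸ 2 * y) * (G m * G y)
    ≤ (s ∸ 2 * m) * (s ∸ 2 * y) * (G (suc m) * G (suc y)) + 2 * s * (G m * G y)
  where s = suc d * suc d

-- With a = d + 1, the factor g(k) = G k / D is charged to an unwired vertex with k unwired
-- neighbours.  The edge inequality is
--   1 − 2 / ((a − 2m/a) (a − 2y/a)) ≤ g(m+1) g(y+1) / (g(m) g(y)),
-- with denominators cleared.
record Profile (d : ℕ) : Set where
  field
    G       : ℕ → ℕ
    D       : ℕ
    D>0     : 0 < D
    G-zero  : G 0 ≡ suc d * D
    G-top   : G d ≡ d * D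
    G>0     : ∀ {k} → k ≤ d → 0 < G k
    edge    : ∀ {m} → m < d → ∀ {y} → y < d → EdgeInequality d G m y

-- The two bounds chain to s X ≤ P Q M₁, so X′ / X = 1 - 2 M₁ / X ≤ 1 - 2 s / (P Q), and the edge
-- inequality bounds this by h / g. The subtracted term is added to both sides to stay in ℕ.
edge-step : ∀ {P Q a s g h X X′ M M₁} → 0 < P → 0 < Q → s ≡ a * a →
  P * Q * g ≤ P * Q * h + 2 * s * g → a * X ≤ P * M → a * M ≤ Q * M₁ → X ≡ X′ + 2 * M₁ →
  X′ * g ≤ X * h
edge-step {P@(suc _)} {Q@(suc _)} {a} {_} {g} {h} {X} {X′} {M} {M₁} _ _ Eq.refl e p q Eq.refl =
  *-cancelˡ-≤ (P * Q) (+-cancelʳ-≤ (2 * (P * Q * M₁) * g) _ _ (begin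
    P * Q * (X′ * g) + 2 * (P * Q * M₁) * g
      ≡⟨ solve 4 (λ r g x m → r :* (x :* g) :+ con 2 :* (r :* m) :* g
                    := (x :+ con 2 :* m) :* (r :* g)) Eq.refl (P * Q) g X′ M₁ ⟩
    X * (P * Q * g)                     ≤⟨ *-monoʳ-≤ X e ⟩
    X * (P * Q * h + 2 * (a * a) * g)
      ≡⟨ solve 5 (λ x r h a g → x :* (r :* h :+ con 2 :* (a :* a) :* g)
                    := r :* (x :* h) :+ con 2 :* (a :* (a :* x)) :* g) Eq.refl X (P * Q) h a g ⟩
    P * Q * (X * h) + 2 * (a * (a * X)) * g
      ≤⟨ +-monoʳ-≤ (P * Q * (X * h)) (*-monoˡ-≤ g (*-monoʳ-≤ 2 aaX≤PQM₁)) ⟩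
    P * Q * (X * h) + 2 * (P * Q * M₁) * g ∎))
  where
  open ≤-Reasoning
  aaX≤PQM₁ : a * (a * X) ≤ P * Q * M₁
  aaX≤PQM₁ = begin
    a * (a * X)     ≤⟨ *-monoʳ-≤ a p ⟩
    a * (P * M)     ≡⟨ solve 3 (λ a p m → a :* (p :* m) := p :* (a :* m)) Eq.refl a P M ⟩
    P * (a * M)     ≤⟨ *-monoʳ-≤ P q ⟩
    P * (Q * M₁)    ≡⟨ *-assoc P Q M₁ ⟨
    P * Q * M₁      ∎

2m<[1+d]² : ∀ {m d} → m < d → 2 * m < suc d * suc d
2m<[1+d]² {m} {d} m<d = begin-strict
  2 * m           <⟨ *-monoʳ-< 2 m<d ⟩
  2 * d           ≤⟨ m≤m+n (2 * d) (suc (d * d)) ⟩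
  2 * d + suc (d * d)
    ≡⟨ solve 1 (λ d → con 2 :* d :+ (con 1 :+ d :* d) := (con 1 :+ d) :* (con 1 :+ d)) Eq.refl d ⟩
  suc d * suc d   ∎
  where open ≤-Reasoning

move-∸ : ∀ {s p x z} → p ≤ s → x + p * z ≤ s * z → x ≤ (s ∸ p) * z
move-∸ {s} {p} {x} {z} p≤s q = +-cancelʳ-≤ (p * z) x _ (begin
  x + p * z                ≤⟨ q ⟩
  s * z                    ≡⟨ cong (_* z) (m∸n+n≡m p≤s) ⟨
  (s ∸ p + p) * z          ≡⟨ *-distribʳ-+ z (s ∸ p) p ⟩
  (s ∸ p) * z + p * z      ∎)
  where open ≤-Reasoning

module _ {d : ℕ} (profile : Profile d) where
  open Profile profile
  private
    a = suc d
    s = a * a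

  -- Writing X_m = a M − 2 Σ_{i<m} M_i, the edge inequality bounds each quotient X_{m+1} / X_m,
  -- because X_m ≤ (a − 2m/a) M and M ≤ (a − 2y/a) M_m.
  charge-neighbours : ∀ {A : Set} (N M : ℕ) (Mᵤ y : A → ℕ) us m X → m + length us ≤ d →
    N + 2 * sum (map Mᵤ us) ≤ X → a * X + 2 * m * M ≤ s * M →
    All (λ u → y u < d × a * M + 2 * y u * Mᵤ u ≤ s * Mᵤ u) us →
    N * (G m * product (map (λ u → G (y u)) us))
      ≤ X * (G (m + length us) * product (map (λ u → G (suc (y u))) us))
  charge-neighbours N M Mᵤ y [] m X _ N≤X _ [] rewrite +-identityʳ m | +-identityʳ N =
    *-monoˡ-≤ (G m * 1) N≤X
  charge-neighbours N M Mᵤ y (u ∷ us) m X m+k≤d N≤X Xb ((y<d , Mb) ∷ bs) =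
    -- The claim for the remaining neighbours starts at `G (suc m)` instead of `G m`; this factor is
    -- positive and is cancelled after use.
    *-cancelˡ-≤ (G (suc m)) ⦃ >-nonZero (G>0 m<d) ⦄ (begin
      G (suc m) * (N * (G m * (G (y u) * Π)))
        ≡⟨ solve 5 (λ h n g k p → h :* (n :* (g :* (k :* p))) := n :* (h :* p) :* (g :* k))
             Eq.refl (G (suc m)) N (G m) (G (y u)) Π ⟩
      N * (G (suc m) * Π) * (G m * G (y u))
        ≤⟨ *-monoˡ-≤ (G m * G (y u)) ih ⟩
      X′ * (K * Π⁺) * (G m * G (y u))
        ≡⟨ solve 3 (λ x r g → x :* r :* g := x :* g :* r) Eq.refl X′ (K * Π⁺) (G m * G (y u)) ⟩
      X′ * (G m * G (y u)) * (K * Π⁺)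
        ≤⟨ *-monoˡ-≤ (K * Π⁺) step ⟩
      X * (G (suc m) * G (suc (y u))) * (K * Π⁺)
        ≡⟨ solve 5 (λ x h k r p → x :* (h :* k) :* (r :* p) := h :* (x :* (r :* (k :* p))))
             Eq.refl X (G (suc m)) (G (suc (y u))) K Π⁺ ⟩
      G (suc m) * (X * (K * (G (suc (y u)) * Π⁺)))
        ≡⟨ cong (λ z → G (suc m) * (X * (G z * (G (suc (y u)) * Π⁺)))) (+-suc m (length us)) ⟨
      G (suc m) * (X * (G (m + suc (length us)) * (G (suc (y u)) * Π⁺))) ∎)
    where
    open ≤-Reasoning
    Π Π⁺ K X′ Σ : ℕ
    Π = product (map (λ u → G (y u)) us)
    Π⁺ = product (map (λ u → G (suc (y u))) us)
    K = G (suc m + length us)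
    Σ = sum (map Mᵤ us)
    X′ = X ∸ 2 * Mᵤ u
    m<d : m < d
    m<d = ≤-trans (s≤s (m≤m+n m (length us))) (≤-trans (≤-reflexive (Eq.sym (+-suc m (length us)))) m+k≤d)
    N≤X′ : N + 2 * Σ + 2 * Mᵤ u ≤ X
    N≤X′ = ≤-trans (≤-reflexive (solve 3 (λ n t m → n :+ con 2 :* t :+ con 2 :* m := n :+ con 2 :* (m :+ t))
      Eq.refl N Σ (Mᵤ u))) N≤X
    X≡ : X ≡ X′ + 2 * Mᵤ u
    X≡ = Eq.sym (m∸n+n≡m (≤-trans (m≤n+m (2 * Mᵤ u) (N + 2 * Σ)) N≤X′))
    M≤ : M ≤ a * Mᵤ u
    M≤ = *-cancelˡ-≤ a (≤-trans (m≤m+n (a * M) (2 * y u * Mᵤ u))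
      (≤-trans Mb (≤-reflexive (*-assoc a a (Mᵤ u)))))
    -- This keeps X_m ≤ (a - 2m/a) M along the list: a X falls by 2 a M_u, which is at least the 2 M
    -- by which the other term rises.
    Xb′ : a * X′ + 2 * suc m * M ≤ s * M
    Xb′ = begin
      a * X′ + 2 * suc m * M
        ≡⟨ solve 4 (λ a x m n → a :* x :+ con 2 :* (con 1 :+ m) :* n
              := a :* x :+ con 2 :* n :+ con 2 :* m :* n) Eq.refl a X′ m M ⟩
      a * X′ + 2 * M + 2 * m * M
        ≤⟨ +-monoˡ-≤ (2 * m * M) (+-monoʳ-≤ (a * X′) (*-monoʳ-≤ 2 M≤)) ⟩
      a * X′ + 2 * (a * Mᵤ u) + 2 * m * M
        ≡⟨ cong (_+ 2 * m * M) (solve 3 (λ a x n → a :* x :+ con 2 :* (a :* n) := a :* (x :+ con 2 :* n))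
              Eq.refl a X′ (Mᵤ u)) ⟩
      a * (X′ + 2 * Mᵤ u) + 2 * m * M   ≡⟨ cong (λ z → a * z + 2 * m * M) X≡ ⟨
      a * X + 2 * m * M                 ≤⟨ Xb ⟩
      s * M                             ∎
    ih : N * (G (suc m) * Π) ≤ X′ * (K * Π⁺)
    ih = charge-neighbours N M Mᵤ y us (suc m) X′
      (≤-trans (≤-reflexive (Eq.sym (+-suc m (length us)))) m+k≤d)
      (+-cancelʳ-≤ (2 * Mᵤ u) _ _ (≤-trans N≤X′ (≤-reflexive X≡))) Xb′ bs
    step : X′ * (G m * G (y u)) ≤ X * (G (suc m) * G (suc (y u)))
    step = edge-step {a = a} {X′ = X′} {M} (m<n⇒0<n∸m (2m<[1+d]² m<d)) (m<n⇒0<n∸m (2m<[1+d]² y<d)) Eq.refl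
      (edge m<d y<d) (move-∸ (<⇒≤ (2m<[1+d]² m<d)) Xb) (move-∸ (<⇒≤ (2m<[1+d]² y<d)) Mb) X≡

-- For every r this quadratic runs from a D at 0 down to d D at d.  The values of r used for d ≤ 11
-- were found by search; r = d² − d − 1 works for all d ≥ 12.
module Quadratic (d r : ℕ) (d>0 : 0 < d) where

  G : ℕ → ℕ
  G k = (r + d) * d * suc d ∸ (r * k + k * k)

  quadratic-profile : (∀ {m} → m < d → ∀ {y} → y < d → EdgeInequality d G m y) → Profile d
  quadratic-profile edge = record
    { G      = G
    ; D      = (r + d) * d
    ; D>0    = D>0
    ; G-zero = Eq.trans (cong ((r + d) * d * suc d ∸_) (Eq.trans (+-identityʳ _) (*-zeroʳ r)))
                 (*-comm ((r + d) * d) (suc d))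
    ; G-top  = G-top
    ; G>0    = λ k≤d → <-≤-trans (subst (0 <_) (Eq.sym G-top) (*-mono-< d>0 D>0))
                 (∸-monoʳ-≤ ((r + d) * d * suc d) (+-mono-≤ (*-monoʳ-≤ r k≤d) (*-mono-≤ k≤d k≤d)))
    ; edge   = edge
    }
    where
    D>0 : 0 < (r + d) * d
    D>0 = *-mono-< (<-≤-trans d>0 (m≤n+m d r)) d>0
    G-top : G d ≡ d * ((r + d) * d)
    G-top = begin
      (r + d) * d * suc d ∸ (r * d + d * d)
        ≡⟨ cong (_∸ (r * d + d * d)) (solve 2 (λ r d → (r :+ d) :* d :* (con 1 :+ d)
             := d :* ((r :+ d) :* d) :+ (r :* d :+ d :* d)) Eq.refl r d) ⟩
      d * ((r + d) * d) + (r * d + d * d) ∸ (r * d + d * d)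
        ≡⟨ m+n∸n≡m (d * ((r + d) * d)) (r * d + d * d) ⟩
      d * ((r + d) * d) ∎
      where open ≡-Reasoning

  -- For numerals d and r these are d² closed inequalities, settled by evaluation.
  edge? : Dec (∀ {m} → m < d → ∀ {y} → y < d → EdgeInequality d G m y)
  edge? = allUpTo? (λ m → allUpTo? (λ y → _ ≤? _) d) d

-- A common bound for the decay of two factors yields the edge inequality, because
-- (s − 2m) (s − 2y) (2s + 4m + 4y) ≤ 2s³.
decay⇒edge : ∀ d (G : ℕ → ℕ) m y → m < d → y < d →
  let s = suc d * suc d in
  G (suc m) ≤ G m →
  s * s * G m ≤ s * s * G (suc m) + (s + 4 * m) * G m →
  s * s * G y ≤ s * s * G (suc y) + (s + 4 * y) * G y →
  EdgeInequality d G m y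
decay⇒edge d G m y m<d y<d g′≤g p q = *-cancelˡ-≤ (s * s) (begin
  s * s * (P * Q * (g * h))
    ≡⟨ solve 3 (λ s r x → s :* s :* (r :* x) := r :* (s :* s :* x)) Eq.refl s (P * Q) (g * h) ⟩
  P * Q * (s * s * (g * h))
    ≤⟨ *-monoʳ-≤ (P * Q) both ⟩
  P * Q * (s * s * (g′ * h′) + (s + 4 * m + (s + 4 * y)) * (g * h))
    ≡⟨ solve 5 (λ r s x u z → r :* (s :* s :* x :+ u :* z) := s :* s :* (r :* x) :+ r :* u :* z)
         Eq.refl (P * Q) s (g′ * h′) (s + 4 * m + (s + 4 * y)) (g * h) ⟩
  s * s * (P * Q * (g′ * h′)) + P * Q * (s + 4 * m + (s + 4 * y)) * (g * h)
    ≤⟨ +-monoʳ-≤ (s * s * (P * Q * (g′ * h′))) (*-monoˡ-≤ (g * h) PQ≤) ⟩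
  s * s * (P * Q * (g′ * h′)) + s * s * (2 * s) * (g * h)
    ≡⟨ solve 4 (λ s w x z → s :* s :* (w :* x) :+ s :* s :* (con 2 :* s) :* z
         := s :* s :* (w :* x :+ con 2 :* s :* z)) Eq.refl s (P * Q) (g′ * h′) (g * h) ⟩
  s * s * (P * Q * (g′ * h′) + 2 * s * (g * h)) ∎)
  where
  open ≤-Reasoning
  s P Q g g′ h h′ : ℕ
  s = suc d * suc d
  P = s ∸ 2 * m
  Q = s ∸ 2 * y
  g = G m
  g′ = G (suc m)
  h = G y
  h′ = G (suc y)
  both : s * s * (g * h) ≤ s * s * (g′ * h′) + (s + 4 * m + (s + 4 * y)) * (g * h)
  both = begin
    s * s * (g * h)                   ≡⟨ *-assoc (s * s) g h ⟨
    s * s * g * h                     ≤⟨ *-monoˡ-≤ h p ⟩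
    (s * s * g′ + (s + 4 * m) * g) * h
      ≡⟨ solve 5 (λ w g′ u g h → (w :* g′ :+ u :* g) :* h := g′ :* (w :* h) :+ u :* (g :* h))
           Eq.refl (s * s) g′ (s + 4 * m) g h ⟩
    g′ * (s * s * h) + (s + 4 * m) * (g * h)
      ≤⟨ +-monoˡ-≤ ((s + 4 * m) * (g * h)) (*-monoʳ-≤ g′ q) ⟩
    g′ * (s * s * h′ + (s + 4 * y) * h) + (s + 4 * m) * (g * h)
      ≡⟨ solve 6 (λ g′ w h′ u h x → g′ :* (w :* h′ :+ u :* h) :+ x
           := w :* (g′ :* h′) :+ g′ :* (u :* h) :+ x)
           Eq.refl g′ (s * s) h′ (s + 4 * y) h ((s + 4 * m) * (g * h)) ⟩
    s * s * (g′ * h′) + g′ * ((s + 4 * y) * h) + (s + 4 * m) * (g * h)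
      ≤⟨ +-monoˡ-≤ _ (+-monoʳ-≤ (s * s * (g′ * h′)) (*-monoˡ-≤ ((s + 4 * y) * h) g′≤g)) ⟩
    s * s * (g′ * h′) + g * ((s + 4 * y) * h) + (s + 4 * m) * (g * h)
      ≡⟨ solve 5 (λ x g u h v → x :+ g :* (u :* h) :+ v :* (g :* h) := x :+ (v :+ u) :* (g :* h))
           Eq.refl (s * s * (g′ * h′)) g (s + 4 * y) h (s + 4 * m) ⟩
    s * s * (g′ * h′) + (s + 4 * m + (s + 4 * y)) * (g * h) ∎
  P+ : P + 2 * m ≡ s
  P+ = m∸n+n≡m (<⇒≤ (2m<[1+d]² m<d))
  Q+ : Q + 2 * y ≡ s
  Q+ = m∸n+n≡m (<⇒≤ (2m<[1+d]² y<d))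
  -- The left side is 2 P (Q (s + 2m) + Q · 2y). Replacing the second Q by s + 2m lets Q + 2y = s
  -- factor out, and (s - 2m)(s + 2m) ≤ s² does the rest.
  PQ≤ : P * Q * (s + 4 * m + (s + 4 * y)) ≤ s * s * (2 * s)
  PQ≤ = begin
    P * Q * (s + 4 * m + (s + 4 * y))
      ≡⟨ solve 5 (λ p q s m y → p :* q :* (s :+ con 4 :* m :+ (s :+ con 4 :* y))
           := con 2 :* p :* (q :* (s :+ con 2 :* m) :+ q :* (con 2 :* y))) Eq.refl P Q s m y ⟩
    2 * P * (Q * (s + 2 * m) + Q * (2 * y))
      ≤⟨ *-monoʳ-≤ (2 * P) (+-monoʳ-≤ (Q * (s + 2 * m))
           (*-monoˡ-≤ (2 * y) (≤-trans (m∸n≤m s (2 * y)) (m≤m+n s (2 * m))))) ⟩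
    2 * P * (Q * (s + 2 * m) + (s + 2 * m) * (2 * y))
      ≡⟨ solve 4 (λ p q u v → con 2 :* p :* (q :* u :+ u :* v) := con 2 :* (q :+ v) :* (p :* u))
           Eq.refl P Q (s + 2 * m) (2 * y) ⟩
    2 * (Q + 2 * y) * (P * (s + 2 * m))
      ≡⟨ cong (λ z → 2 * z * (P * (s + 2 * m))) Q+ ⟩
    2 * s * (P * (s + 2 * m))
      ≤⟨ *-monoʳ-≤ (2 * s) P[s+2m]≤s² ⟩
    2 * s * (s * s)
      ≡⟨ solve 1 (λ s → con 2 :* s :* (s :* s) := s :* s :* (con 2 :* s)) Eq.refl s ⟩
    s * s * (2 * s) ∎
    where
    P[s+2m]≤s² : P * (s + 2 * m) ≤ s * s
    P[s+2m]≤s² = begin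
      P * (s + 2 * m)       ≡⟨ *-distribˡ-+ P s (2 * m) ⟩
      P * s + P * (2 * m)   ≤⟨ +-monoʳ-≤ (P * s) (*-monoˡ-≤ (2 * m) (m∸n≤m s (2 * m))) ⟩
      P * s + s * (2 * m)   ≡⟨ cong (P * s +_) (*-comm s (2 * m)) ⟩
      P * s + 2 * m * s     ≡⟨ *-distribʳ-+ s P (2 * m) ⟨
      (P + 2 * m) * s       ≡⟨ cong (_* s) P+ ⟩
      s * s                 ∎

-- Quadratic profiles for all d ≥ 12.

module _ (e : ℕ) where
  private
    d r c s : ℕ
    d = 12 + e
    -- This is d² - d - 1, the largest r for which the decay bound holds at m = 0, where it is then
    -- an equality. It makes r + 1 = c and G 0 = c s.
    r = 131 + 23 * e + e * e
    c = d * (11 + e)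
    s = suc d * suc d

    open Quadratic d r (s≤s z≤n)

    T : ℕ → ℕ
    T k = r * k + k * k

    1+r≡c : suc r ≡ c
    1+r≡c = solve 1 (λ e → con 132 :+ con 23 :* e :+ e :* e := (con 12 :+ e) :* (con 11 :+ e)) Eq.refl e

    aD≡cs : (r + d) * d * suc d ≡ c * s
    aD≡cs = solve 1 (λ e → (con 131 :+ con 23 :* e :+ e :* e :+ (con 12 :+ e)) :* (con 12 :+ e) :* (con 13 :+ e)
      := (con 12 :+ e) :* (con 11 :+ e) :* ((con 13 :+ e) :* (con 13 :+ e))) Eq.refl e

    T≤ : ∀ {k} → k ≤ d → T k ≤ (r + d) * d * suc d
    T≤ {k} k≤d = begin
      r * k + k * k         ≤⟨ +-mono-≤ (*-monoʳ-≤ r k≤d) (*-mono-≤ k≤d k≤d) ⟩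
      r * d + d * d         ≡⟨ *-distribʳ-+ d r d ⟨
      (r + d) * d           ≤⟨ m≤m*n ((r + d) * d) (suc d) ⟩
      (r + d) * d * suc d   ∎
      where open ≤-Reasoning

    G+T : ∀ {k} → k ≤ d → G k + T k ≡ (r + d) * d * suc d
    G+T k≤d = m∸n+n≡m (T≤ k≤d)

    G-suc : ∀ {m} → m < d → G m ≡ G (suc m) + (c + 2 * m)
    G-suc {m} m<d = +-cancelʳ-≡ (T m) _ _ (begin
      G m + T m                                ≡⟨ G+T (<⇒≤ m<d) ⟩
      (r + d) * d * suc d                      ≡⟨ G+T m<d ⟨
      G (suc m) + T (suc m)
        ≡⟨ solve 3 (λ g r m → g :+ (r :* (con 1 :+ m) :+ (con 1 :+ m) :* (con 1 :+ m))
             := g :+ ((con 1 :+ r) :+ con 2 :* m) :+ (r :* m :+ m :* m)) Eq.refl (G (suc m)) r m ⟩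
      G (suc m) + (suc r + 2 * m) + T m        ≡⟨ cong (λ z → G (suc m) + (z + 2 * m) + T m) 1+r≡c ⟩
      G (suc m) + (c + 2 * m) + T m            ∎)
      where open ≡-Reasoning

    -- The difference of the two sides is d² (d − 11) (d + 1) − 8.
    top-bound : 2 * (s * s) + (c + (10 + e)) * (s + 4 * (11 + e)) ≤ 4 * (c * s)
    top-bound = begin
      lhs   ≤⟨ m≤m+n lhs (1864 + 2328 * e + 493 * (e * e) + 38 * (e * e * e) + e * e * (e * e)) ⟩
      lhs + (1864 + 2328 * e + 493 * (e * e) + 38 * (e * e * e) + e * e * (e * e))
        ≡⟨ solve 1 (λ e → let d = con 12 :+ e ; a = con 13 :+ e ; s = a :* a ; c = d :* (con 11 :+ e) in
             con 2 :* (s :* s) :+ (c :+ (con 10 :+ e)) :* (s :+ con 4 :* (con 11 :+ e)) :+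
               (con 1864 :+ con 2328 :* e :+ con 493 :* (e :* e) :+ con 38 :* (e :* e :* e) :+ e :* e :* (e :* e))
             := con 4 :* (c :* s)) Eq.refl e ⟩
      4 * (c * s) ∎
      where
      open ≤-Reasoning
      lhs = 2 * (s * s) + (c + (10 + e)) * (s + 4 * (11 + e))

    -- The decay bound with c s - T m put for G m. The terms c s² cancel, and after division by m
    -- the left side still grows with m while the right side is constant; so m = d - 1, treated in
    -- `top-bound`, is the worst case.
    T-bound : ∀ {m} → m < d → (c + 2 * m) * (s * s) + T m * (s + 4 * m) ≤ c * s * (s + 4 * m)
    T-bound {zero}  _         = ≤-reflexive (Eq.trans (cong (λ z → (c + 0) * (s * s) + z * (s + 0))
      (Eq.trans (+-identityʳ _) (*-zeroʳ r)))
      (solve 2 (λ c s → (c :+ con 0) :* (s :* s) :+ con 0 := c :* s :* (s :+ con 0)) Eq.refl c s))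
    T-bound {suc j} (s≤s j<) = begin
      (c + 2 * m) * (s * s) + T m * (s + 4 * m)
        ≡⟨ solve 4 (λ c s r j → let m = con 1 :+ j in
             (c :+ con 2 :* m) :* (s :* s) :+ (r :* m :+ m :* m) :* (s :+ con 4 :* m)
             := c :* (s :* s) :+ m :* (con 2 :* (s :* s) :+ ((con 1 :+ r) :+ j) :* (s :+ con 4 :* m)))
             Eq.refl c s r j ⟩
      c * (s * s) + m * (2 * (s * s) + (suc r + j) * (s + 4 * m))
        ≡⟨ cong (λ z → c * (s * s) + m * (2 * (s * s) + (z + j) * (s + 4 * m))) 1+r≡c ⟩
      c * (s * s) + m * (2 * (s * s) + (c + j) * (s + 4 * m))
        ≤⟨ +-monoʳ-≤ (c * (s * s)) (*-monoʳ-≤ m (+-monoʳ-≤ (2 * (s * s))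
             (*-mono-≤ (+-monoʳ-≤ c j≤) (+-monoʳ-≤ s (*-monoʳ-≤ 4 (s≤s j≤)))))) ⟩
      c * (s * s) + m * (2 * (s * s) + (c + (10 + e)) * (s + 4 * (11 + e)))
        ≤⟨ +-monoʳ-≤ (c * (s * s)) (*-monoʳ-≤ m top-bound) ⟩
      c * (s * s) + m * (4 * (c * s))
        ≡⟨ solve 3 (λ c s m → c :* (s :* s) :+ m :* (con 4 :* (c :* s)) := c :* s :* (s :+ con 4 :* m))
             Eq.refl c s m ⟩
      c * s * (s + 4 * m) ∎
      where
      open ≤-Reasoning
      m = suc j
      j≤ : j ≤ 10 + e
      j≤ = ≤-pred j<

    decay : ∀ {m} → m < d → s * s * G m ≤ s * s * G (suc m) + (s + 4 * m) * G m
    decay {m} m<d = begin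
      s * s * G m                              ≡⟨ cong (s * s *_) (G-suc m<d) ⟩
      s * s * (G (suc m) + (c + 2 * m))        ≡⟨ *-distribˡ-+ (s * s) (G (suc m)) (c + 2 * m) ⟩
      s * s * G (suc m) + s * s * (c + 2 * m)  ≤⟨ +-monoʳ-≤ (s * s * G (suc m)) drop ⟩
      s * s * G (suc m) + (s + 4 * m) * G m    ∎
      where
      open ≤-Reasoning
      drop : s * s * (c + 2 * m) ≤ (s + 4 * m) * G m
      drop = +-cancelʳ-≤ (T m * (s + 4 * m)) _ _ (begin
        s * s * (c + 2 * m) + T m * (s + 4 * m)  ≡⟨ cong (_+ T m * (s + 4 * m)) (*-comm (s * s) (c + 2 * m)) ⟩
        (c + 2 * m) * (s * s) + T m * (s + 4 * m)  ≤⟨ T-bound m<d ⟩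
        c * s * (s + 4 * m)                      ≡⟨ cong (_* (s + 4 * m)) (Eq.trans (G+T (<⇒≤ m<d)) aD≡cs) ⟨
        (G m + T m) * (s + 4 * m)
          ≡⟨ solve 3 (λ g t u → (g :+ t) :* u := u :* g :+ t :* u) Eq.refl (G m) (T m) (s + 4 * m) ⟩
        (s + 4 * m) * G m + T m * (s + 4 * m)    ∎)

  large-profile : Profile (12 + e)
  large-profile = quadratic-profile λ {m} m<d {y} y<d →
    decay⇒edge d G m y m<d y<d
      (≤-trans (m≤m+n _ _) (≤-reflexive (Eq.sym (G-suc m<d)))) (decay m<d) (decay y<d)

profile : ∀ {d} → 5 ≤ d → Profile d
profile {0}  ()
profile {1}  (s≤s ())
profile {2}  (s≤s (s≤s ()))
profile {3}  (s≤s (s≤s (s≤s ())))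
profile {4}  (s≤s (s≤s (s≤s (s≤s ()))))
profile {5}  _ = let open Quadratic 5 13 (s≤s z≤n) in quadratic-profile (from-yes edge?)
profile {6}  _ = let open Quadratic 6 17 (s≤s z≤n) in quadratic-profile (from-yes edge?)
profile {7}  _ = let open Quadratic 7 23 (s≤s z≤n) in quadratic-profile (from-yes edge?)
profile {8}  _ = let open Quadratic 8 30 (s≤s z≤n) in quadratic-profile (from-yes edge?)
profile {9}  _ = let open Quadratic 9 38 (s≤s z≤n) in quadratic-profile (from-yes edge?)
profile {10} _ = let open Quadratic 10 47 (s≤s z≤n) in quadratic-profile (from-yes edge?)
profile {11} _ = let open Quadratic 11 56 (s≤s z≤n) in quadratic-profile (from-yes edge?)
profile {suc (suc (suc (suc (suc (suc (suc (suc (suc (suc (suc (suc e)))))))))))} _ = large-profile e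

-- Graphs

-- Suited to labels that are themselves vertices of the class they name, as in `wired`: each vertex
-- need only be compared with its representative.
collapse⇒≼ : {π ρ : Labelling n} → (∀ x → ρ x ≡ ρ (π x)) → π ≼ ρ
collapse⇒≼ {ρ = ρ} h = coarser λ {x} {y} e → Eq.trans (h x) (Eq.trans (cong ρ e) (Eq.sym (h y)))

^-distribʳ-* : ∀ k x y → (x * y) ^ k ≡ x ^ k * y ^ k
^-distribʳ-* zero    x y = Eq.refl
^-distribʳ-* (suc k) x y = Eq.trans (cong (x * y *_) (^-distribʳ-* k x y))
  (solve 4 (λ x y p q → x :* y :* (p :* q) := x :* p :* (y :* q)) Eq.refl x y (x ^ k) (y ^ k))

module GraphCounts {n : ℕ} (Γ : SimpleGraph n) where

  open import Data.List.Membership.DecPropositional (_≟_ {n}) using (_∈?_)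

  neighbours : Fin n → List (Fin n) → List (Fin n)
  neighbours v L = filter (λ u → adj Γ v u ≟ᵇ true) L

  deg : List (Fin n) → Fin n → ℕ
  deg L v = length (neighbours v L)

  neighbours-∷-adj : ∀ {v w} L → adj Γ v w ≡ true → neighbours v (w ∷ L) ≡ w ∷ neighbours v L
  neighbours-∷-adj {v} L = filter-accept (λ u → adj Γ v u ≟ᵇ true)

  neighbours-∷-nonadj : ∀ {v w} L → adj Γ v w ≡ false → neighbours v (w ∷ L) ≡ neighbours v L
  neighbours-∷-nonadj {v} L e =
    filter-reject (λ u → adj Γ v u ≟ᵇ true) λ t → case Eq.trans (Eq.sym e) t of λ ()

  deg-∷-self : ∀ v L → deg (v ∷ L) v ≡ deg L v
  deg-∷-self v L = cong length (neighbours-∷-nonadj L (irrefl Γ v))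

  deg-++ : ∀ L W v → deg (L ++ W) v ≡ deg L v + deg W v
  deg-++ L W v = Eq.trans (cong length (filter-++ (λ u → adj Γ v u ≟ᵇ true) L W))
    (length-++ (neighbours v L))

  deg-↭ : ∀ {L L′} → L ↭ L′ → ∀ v → deg L v ≡ deg L′ v
  deg-↭ p v = ↭-length (filter-↭ (λ u → adj Γ v u ≟ᵇ true) p)

  neighbours-⊆ : ∀ v L → All (_∈ L) (neighbours v L)
  neighbours-⊆ v L = All.tabulate λ m → proj₁ (∈-filter⁻ (λ u → adj Γ v u ≟ᵇ true) m)

  -- The vertex w of the graph is suc w; the extra vertex zero receives the wired vertices.
  edges : List (Fin n) → List (Edge (suc n))
  edges []      = []
  edges (v ∷ L) = star (suc v) (map suc (neighbours v L)) ++ edges L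

  -- The order of the vertices decides only at which end an edge is recorded: exchanging v and w
  -- flips vw, if present, and permutes the other edges.
  edges-swap : ∀ v w L → edges (v ∷ w ∷ L) ≅ edges (w ∷ v ∷ L)
  edges-swap v w L with adj Γ v w in p | adj Γ w v in q
  ... | true  | false with () ← Eq.trans (Eq.sym p) (Eq.trans (symm Γ v w) q)
  ... | false | true  with () ← Eq.trans (Eq.sym p) (Eq.trans (symm Γ v w) q)
  ... | true  | true =
    ≅-trans (flip-≅ (suc v) (suc w) _)
      (∷-≅ (suc w , suc v) (↭⇒≅ (shifts (star (suc v) (map suc (neighbours v L)))
        (star (suc w) (map suc (neighbours w L))))))
  ... | false | false =
    ↭⇒≅ (shifts (star (suc v) (map suc (neighbours v L))) (star (suc w) (map suc (neighbours w L))))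

  edges-∷ : ∀ {L L′} v → L ↭ L′ → edges L ≅ edges L′ → edges (v ∷ L) ≅ edges (v ∷ L′)
  edges-∷ {L} {L′} v p q = ≅-trans
    (++-≅ (star (suc v) (map suc (neighbours v L))) q)
    (↭⇒≅ (++⁺ʳ (edges L′) (map⁺ (suc v ,_) (map⁺ suc (filter-↭ (λ u → adj Γ v u ≟ᵇ true) p)))))

  edges-↭ : ∀ {L L′} → L ↭ L′ → edges L ≅ edges L′
  edges-↭ refl                = equinumerous λ _ → Eq.refl
  edges-↭ (prep v p)          = edges-∷ v p (edges-↭ p)
  edges-↭ (swap {xs = L} v w p) =
    ≅-trans (edges-swap v w L) (edges-∷ w (prep v p) (edges-∷ v p (edges-↭ p)))
  edges-↭ (trans p q)         = ≅-trans (edges-↭ p) (edges-↭ q)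

  edges-avoid : ∀ {v} L → v ∉ L → All (λ e → proj₁ e ≢ suc v × proj₂ e ≢ suc v) (edges L)
  edges-avoid []      v∉ = []
  edges-avoid (w ∷ L) v∉ = All.++⁺
    (All.map⁺ (All.map⁺ (All.map
      (λ u∈ → (λ e → v∉ (here (suc-injective (Eq.sym e))))
            , (λ e → v∉ (there (subst (_∈ L) (suc-injective e) u∈))))
      (neighbours-⊆ w L))))
    (edges-avoid L (v∉ ∘ there))

  -- Here `L` holds the unwired vertices, so S is its complement. Keeping the complement makes the
  -- induction structural and `deg L v` the number of unwired neighbours.
  wired : List (Fin n) → Labelling (suc n)
  wired L zero    = zero
  wired L (suc w) = if does (w ∈? L) then suc w else zero

  wired-∈ : ∀ {w L} → w ∈ L → wired L (suc w) ≡ suc w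
  wired-∈ {w} {L} w∈ with w ∈? L
  ... | yes _ = Eq.refl
  ... | no w∉ = ⊥-elim (w∉ w∈)

  wired-∉ : ∀ {w L} → w ∉ L → wired L (suc w) ≡ zero
  wired-∉ {w} {L} w∉ with w ∈? L
  ... | yes w∈ = ⊥-elim (w∉ w∈)
  ... | no _   = Eq.refl

  wired-mono : ∀ {L L′} → L′ ⊆ L → wired L ≼ wired L′
  wired-mono {L} {L′} sub = collapse⇒≼ collapse
    where
    collapse : ∀ x → wired L′ x ≡ wired L′ (wired L x)
    collapse zero    = Eq.refl
    collapse (suc w) with w ∈? L
    ... | yes _ = Eq.refl
    ... | no w∉ = wired-∉ (w∉ ∘ sub)

  wired≼merge : ∀ v L → wired L ≼ merge (wired (v ∷ L)) (suc v) zero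
  wired≼merge v L = collapse⇒≼ collapse
    where
    ρ = merge (wired (v ∷ L)) (suc v) zero
    split : ∀ w → Dec (w ∈ L) → Dec (w ≡ v) → ρ (suc w) ≡ ρ (wired L (suc w))
    split w (yes w∈) _             = cong ρ (Eq.sym (wired-∈ w∈))
    split w (no w∉)  (yes Eq.refl) =
      Eq.trans (merge-joins (wired (v ∷ L)) (suc v) zero) (cong ρ (Eq.sym (wired-∉ w∉)))
    split w (no w∉)  (no w≢v)      =
      Eq.trans (related (≼-merge (wired (v ∷ L)) (suc v) zero) {suc w} {zero} (wired-∉ w∉v∷L))
        (cong ρ (Eq.sym (wired-∉ w∉)))
      where
      w∉v∷L : w ∉ v ∷ L
      w∉v∷L (here e)  = w≢v e
      w∉v∷L (there m) = w∉ m
    collapse : ∀ x → ρ x ≡ ρ (wired L x)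
    collapse zero    = Eq.refl
    collapse (suc w) = split w (w ∈? L) (w ≟ v)

  merge≼wired : ∀ {v L} → v ∉ L → merge (wired (v ∷ L)) (suc v) zero ≼ wired L
  merge≼wired {v} v∉ = merge-least {x = suc v} {zero} (wired-mono there) (wired-∉ v∉)

  wired-fixes : ∀ {v L} → v ∈ L → ∀ w → wired L w ≡ wired L (suc v) → w ≡ suc v
  wired-fixes v∈ zero    e with () ← Eq.trans e (wired-∈ v∈)
  wired-fixes {L = L} v∈ (suc w) e with w ∈? L
  ... | yes _ = Eq.trans e (wired-∈ v∈)
  ... | no _ with () ← Eq.trans e (wired-∈ v∈)

  allEdges : List (Edge (suc n))
  allEdges = edges (allFin n)

  -- N(S) for S the complement of `L`; the full list corresponds to S = ∅.
  count : List (Fin n) → ℕ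
  count L = forests allEdges (wired L)

  -- N(S + u) for u in `L`, written without deleting u from the list; `countWiring-∷` identifies it
  -- with the `count` of what remains.
  countWiring : List (Fin n) → Fin n → ℕ
  countWiring L u = forests allEdges (merge (wired L) (suc u) zero)

  count-⊆ : ∀ {L L′} → L ⊆ L′ → L′ ⊆ L → count L ≡ count L′
  count-⊆ p q = forests-cong allEdges (wired-mono q) (wired-mono p)

  -- With v already joined to the vertex zero, contracting vu is the same as wiring u.
  through-wired : ∀ {v u L} → v ∉ L → u ∈ L →
    through allEdges (suc v , suc u) (merge (wired (v ∷ L)) (suc v) zero) ≡ countWiring L u
  through-wired {v} {u} {L} v∉ u∈ =
    Eq.trans (through-nonloop ρ {suc v} {suc u} allEdges nonloop) (forests-cong allEdges ρvu≼ρ₀ ρ₀≼ρvu)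
    where
    ρ = merge (wired (v ∷ L)) (suc v) zero
    ρvu = merge ρ (suc v) (suc u)
    ρ₀ = merge (wired L) (suc u) zero
    nonloop : ρ (suc v) ≢ ρ (suc u)
    nonloop e with () ← Eq.trans (Eq.sym (wired-∉ v∉))
      (Eq.trans (related (merge≼wired v∉) {suc v} {suc u} e) (wired-∈ u∈))
    u~v : ρ₀ (suc v) ≡ ρ₀ (suc u)
    u~v = Eq.trans (related (≼-merge (wired L) (suc u) zero) {suc v} {zero} (wired-∉ v∉))
      (Eq.sym (merge-joins (wired L) (suc u) zero))
    u~0 : ρvu (suc u) ≡ ρvu zero
    u~0 = Eq.trans {j = ρvu (suc v)} (Eq.sym (merge-joins ρ (suc v) (suc u)))
      (related (≼-merge ρ (suc v) (suc u)) {suc v} {zero} (merge-joins (wired (v ∷ L)) (suc v) zero))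
    ρvu≼ρ₀ : ρvu ≼ ρ₀
    ρvu≼ρ₀ = merge-least {x = suc v} {suc u} (≼-trans (merge≼wired v∉) (≼-merge (wired L) (suc u) zero)) u~v
    ρ₀≼ρvu : ρ₀ ≼ ρvu
    ρ₀≼ρvu = merge-least {x = suc u} {zero} (≼-trans (wired≼merge v L) (≼-merge ρ (suc v) (suc u))) u~0

  throughs-wired : ∀ {v L} us → v ∉ L → All (_∈ L) us →
    sum (map (countWiring L) us)
      ≡ throughs allEdges (suc v) (map suc us) (merge (wired (v ∷ L)) (suc v) zero)
  throughs-wired []       v∉ []         = Eq.refl
  throughs-wired (u ∷ us) v∉ (u∈ ∷ us∈) =
    cong₂ _+_ (Eq.sym (through-wired v∉ u∈)) (throughs-wired us v∉ us∈)

  throughs-++ : ∀ es v us vs (π : Labelling (suc n)) →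
    throughs es v us π ≤ throughs es v (us ++ vs) π
  throughs-++ es v []       vs π = z≤n
  throughs-++ es v (u ∷ us) vs π = +-monoʳ-≤ (through es (v , u) π) (throughs-++ es v us vs π)

  unique-resp : ∀ {L L′ : List (Fin n)} → L ↭ L′ → Unique L → Unique L′
  unique-resp p = Unique-resp-↭ (Eq.setoid (Fin n)) (↭⇒↭ₛ p)

  head-∉ : ∀ {v : Fin n} {X} → v ∷ X ↭ allFin n → v ∉ X
  head-∉ p with unique-resp (↭-sym p) (allFin⁺ n)
  ... | v# ∷ _ = All.All¬⇒¬Any v#

  ∈⇒↭ : ∀ {u : Fin n} {L} → u ∈ L → ∃ λ L′ → L ↭ u ∷ L′
  ∈⇒↭ u∈ with ∈-∃++ u∈
  ... | ys , zs , Eq.refl = ys ++ zs , shift _ ys zs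

  countWiring-∷ : ∀ {u L L′} → L ↭ u ∷ L′ → u ∉ L′ → countWiring L u ≡ count L′
  countWiring-∷ {u} {L} {L′} q u∉ = Eq.sym (Eq.trans
    (forests-cong allEdges (wired≼merge u L′) (merge≼wired u∉))
    (forests-cong allEdges
      (merge-mono {x = suc u} {zero} (wired-mono (∈-resp-↭ q)))
      (merge-mono {x = suc u} {zero} (wired-mono (∈-resp-↭ (↭-sym q))))))

  handshake : ∀ L → length (edges L) + length (edges L) ≡ sum (map (deg L) L)
  handshake []      = Eq.refl
  handshake (v ∷ L) = begin
    length (edges (v ∷ L)) + length (edges (v ∷ L))
      ≡⟨ cong (λ z → z + z) size ⟩
    (deg L v + length (edges L)) + (deg L v + length (edges L))
      ≡⟨ solve 2 (λ k e → k :+ e :+ (k :+ e) := k :+ (k :+ (e :+ e))) Eq.refl (deg L v) (length (edges L)) ⟩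
    deg L v + (deg L v + (length (edges L) + length (edges L)))
      ≡⟨ cong (λ z → deg L v + (deg L v + z)) (handshake L) ⟩
    deg L v + (deg L v + sum (map (deg L) L))
      ≡⟨ cong₂ _+_ (deg-∷-self v L) (degrees L) ⟨
    deg (v ∷ L) v + sum (map (deg (v ∷ L)) L) ∎
    where
    open ≡-Reasoning
    size : length (edges (v ∷ L)) ≡ deg L v + length (edges L)
    size = Eq.trans (length-++ (star (suc v) (map suc (neighbours v L))))
      (cong (_+ length (edges L)) (Eq.trans (length-map (suc v ,_) (map suc (neighbours v L)))
        (length-map suc (neighbours v L))))
    degrees : ∀ X → sum (map (deg (v ∷ L)) X) ≡ deg X v + sum (map (deg L) X)
    degrees []      = Eq.refl
    degrees (x ∷ X) with adj Γ v x in e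
    ... | true  = Eq.trans
      (cong₂ _+_ (cong length (neighbours-∷-adj L (Eq.trans (symm Γ x v) e))) (degrees X))
      (solve 3 (λ a b c → con 1 :+ a :+ (b :+ c) := con 1 :+ b :+ (a :+ c)) Eq.refl
        (deg L x) (deg X v) (sum (map (deg L) X)))
    ... | false = Eq.trans
      (cong₂ _+_ (cong length (neighbours-∷-nonadj L (Eq.trans (symm Γ x v) e))) (degrees X))
      (solve 3 (λ a b c → a :+ (b :+ c) := b :+ (a :+ c)) Eq.refl
        (deg L x) (deg X v) (sum (map (deg L) X)))

  -- Ratio bounds and the induction for regular graphs.

  module Bounds {d : ℕ} (regular : Regular d Γ) where

    private
      a = suc d

    -- Before v is wired, S is the set listed by `W`. The general bound sums over all neighbours of
    -- v; only those in `L` are kept.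
    wire : ∀ v L W → v ∷ L ++ W ↭ allFin n →
      count (v ∷ L) + 2 * sum (map (countWiring L) (neighbours v L)) ≤ a * count L
    wire v L W p = begin
      count (v ∷ L) + 2 * sum (map (countWiring L) (neighbours v L))
        ≤⟨ +-monoʳ-≤ (count (v ∷ L)) (*-monoʳ-≤ 2 sums) ⟩
      count (v ∷ L) + 2 * throughs allEdges (suc v) us ρ
        ≡⟨ cong₂ (λ x y → x + 2 * y) (forests-≡ order (wired (v ∷ L))) (throughs-≅ order (suc v) us ρ) ⟩
      forests (rest ++ star (suc v) us) (wired (v ∷ L))
        + 2 * throughs (rest ++ star (suc v) us) (suc v) us ρ
        ≤⟨ wiring-bound (suc v) zero us rest (wired (v ∷ L))
             (edges-avoid (L ++ W) (head-∉ p)) (wired-fixes (here Eq.refl)) ⟩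
      suc (length us) * forests (rest ++ star (suc v) us) ρ
        ≡⟨ cong₂ (λ x y → suc x * y) degree≡ (forests-≡ order ρ) ⟨
      a * forests allEdges ρ
        ≡⟨ cong (a *_) (forests-cong allEdges (merge≼wired v∉L) (wired≼merge v L)) ⟩
      a * count L ∎
      where
      open ≤-Reasoning
      us = map suc (neighbours v (L ++ W))
      rest = edges (L ++ W)
      ρ = merge (wired (v ∷ L)) (suc v) zero
      v∉L : v ∉ L
      v∉L m = head-∉ p (∈-++⁺ˡ m)
      -- Listing v first gathers its edges into one block at the front, which is then moved behind
      -- all other edges.
      order : allEdges ≅ rest ++ star (suc v) us
      order = ≅-trans (edges-↭ (↭-sym p)) (↭⇒≅ (++-comm (star (suc v) us) rest))
      degree≡ : d ≡ length us
      degree≡ = Eq.trans (Eq.sym (regular v)) (Eq.trans (deg-↭ (↭-sym p) v)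
        (Eq.trans (deg-∷-self v (L ++ W)) (Eq.sym (length-map suc (neighbours v (L ++ W))))))
      sums : sum (map (countWiring L) (neighbours v L)) ≤ throughs allEdges (suc v) us ρ
      sums = begin
        sum (map (countWiring L) (neighbours v L))
          ≡⟨ throughs-wired (neighbours v L) v∉L (neighbours-⊆ v L) ⟩
        throughs allEdges (suc v) (map suc (neighbours v L)) ρ
          ≤⟨ throughs-++ allEdges (suc v) (map suc (neighbours v L)) (map suc (neighbours v W)) ρ ⟩
        throughs allEdges (suc v) (map suc (neighbours v L) ++ map suc (neighbours v W)) ρ
          ≡⟨ cong (λ z → throughs allEdges (suc v) z ρ) (map-++ suc (neighbours v L) (neighbours v W)) ⟨
        throughs allEdges (suc v) (map suc (neighbours v L ++ neighbours v W)) ρ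
          ≡⟨ cong (λ z → throughs allEdges (suc v) (map suc z) ρ)
               (filter-++ (λ u → adj Γ v u ≟ᵇ true) L W) ⟨
        throughs allEdges (suc v) us ρ ∎

    -- This is r_u ≤ a: the wiring inequality at u with its sum dropped.
    count≤countWiring : ∀ {v u} L W → v ∷ L ++ W ↭ allFin n → u ∈ L → count L ≤ a * countWiring L u
    count≤countWiring {v} {u} L W p u∈ with ∈⇒↭ u∈
    ... | L′ , q = begin
      count L                      ≡⟨ count-⊆ (∈-resp-↭ q) (∈-resp-↭ (↭-sym q)) ⟩
      count (u ∷ L′)               ≤⟨ m≤m+n _ _ ⟩
      count (u ∷ L′) + 2 * sum (map (countWiring L′) (neighbours u L′))
                                   ≤⟨ wire u L′ (v ∷ W) p′ ⟩
      a * count L′                 ≡⟨ cong (a *_) L′≡ ⟩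
      a * countWiring L u          ∎
      where
      open ≤-Reasoning
      p′ : u ∷ L′ ++ v ∷ W ↭ allFin n
      p′ = ↭-trans (++⁺ʳ (v ∷ W) (↭-sym q)) (↭-trans (shift v L W) p)
      u∉ : u ∉ L′
      u∉ m = head-∉ p′ (∈-++⁺ˡ m)
      L′≡ : count L′ ≡ countWiring L u
      L′≡ = Eq.sym (countWiring-∷ q u∉)

    -- This is r_v ≤ a - 2k/a, multiplied by a N(S + v); it inserts 1/r_u ≥ 1/a into the wiring
    -- inequality.
    wire-degree : ∀ v L W → v ∷ L ++ W ↭ allFin n →
      a * count (v ∷ L) + 2 * deg L v * count L ≤ a * a * count L
    wire-degree v L W p = begin
      a * count (v ∷ L) + 2 * deg L v * count L
        ≡⟨ cong (a * count (v ∷ L) +_) (*-assoc 2 (deg L v) (count L)) ⟩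
      a * count (v ∷ L) + 2 * (deg L v * count L)
        ≤⟨ +-monoʳ-≤ (a * count (v ∷ L)) (*-monoʳ-≤ 2 (each (neighbours v L) (neighbours-⊆ v L))) ⟩
      a * count (v ∷ L) + 2 * (a * Σ)
        ≡⟨ solve 3 (λ a c s → a :* c :+ con 2 :* (a :* s) := a :* (c :+ con 2 :* s)) Eq.refl a (count (v ∷ L)) Σ ⟩
      a * (count (v ∷ L) + 2 * Σ)     ≤⟨ *-monoʳ-≤ a (wire v L W p) ⟩
      a * (a * count L)               ≡⟨ *-assoc a a (count L) ⟨
      a * a * count L                 ∎
      where
      open ≤-Reasoning
      Σ = sum (map (countWiring L) (neighbours v L))
      each : ∀ us → All (_∈ L) us → length us * count L ≤ a * sum (map (countWiring L) us)
      each []       []         = z≤n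
      each (u ∷ us) (u∈ ∷ us∈) = ≤-trans
        (+-mono-≤ (count≤countWiring L W p u∈) (each us us∈))
        (≤-reflexive (Eq.sym (*-distribˡ-+ a (countWiring L u) _)))

    deg-< : ∀ {v u} L W → v ∷ L ++ W ↭ allFin n → adj Γ v u ≡ true → deg L u < d
    deg-< {v} {u} L W p e = begin-strict
      deg L u              ≤⟨ m≤m+n (deg L u) (deg W u) ⟩
      deg L u + deg W u    ≡⟨ deg-++ L W u ⟨
      deg (L ++ W) u       <⟨ ≤-refl ⟩
      suc (deg (L ++ W) u) ≡⟨ cong length (neighbours-∷-adj (L ++ W) (Eq.trans (symm Γ u v) e)) ⟨
      deg (v ∷ L ++ W) u   ≡⟨ deg-↭ p u ⟩
      deg (allFin n) u     ≡⟨ regular u ⟩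
      d                    ∎
      where open ≤-Reasoning

    module _ (profile : Profile d) where
      open Profile profile

      -- Adding v to the unwired vertices raises the degree by one exactly at the neighbours of v.
      -- The statement exchanges their factors crosswise to avoid quotients, and `X` is separate
      -- from `L` so that the induction leaves the degrees fixed.
      transfer : ∀ v L X →
        product (map (λ w → G (deg (v ∷ L) w)) X) * product (map (λ u → G (deg L u)) (neighbours v X))
          ≡ product (map (λ w → G (deg L w)) X) * product (map (λ u → G (suc (deg L u))) (neighbours v X))
      transfer v L []      = Eq.refl
      transfer v L (x ∷ X) = split (adj Γ v x) Eq.refl
        where
        open ≡-Reasoning
        A A⁺ B B⁺ : ℕ
        A = product (map (λ w → G (deg L w)) X)
        A⁺ = product (map (λ w → G (deg (v ∷ L) w)) X)
        B = product (map (λ u → G (deg L u)) (neighbours v X))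
        B⁺ = product (map (λ u → G (suc (deg L u))) (neighbours v X))
        Goal : List (Fin n) → Set
        Goal us =
          G (deg (v ∷ L) x) * A⁺ * product (map (λ u → G (deg L u)) us)
            ≡ G (deg L x) * A * product (map (λ u → G (suc (deg L u))) us)
        split : ∀ b → adj Γ v x ≡ b → Goal (neighbours v (x ∷ X))
        split true e = subst Goal (Eq.sym (neighbours-∷-adj X e)) (begin
          G (deg (v ∷ L) x) * A⁺ * (G (deg L x) * B)
            ≡⟨ cong (λ z → G z * A⁺ * (G (deg L x) * B))
                 (cong length (neighbours-∷-adj L (Eq.trans (symm Γ x v) e))) ⟩
          G (suc (deg L x)) * A⁺ * (G (deg L x) * B)
            ≡⟨ solve 4 (λ g a h b → g :* a :* (h :* b) := g :* h :* (a :* b)) Eq.refl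
                 (G (suc (deg L x))) A⁺ (G (deg L x)) B ⟩
          G (suc (deg L x)) * G (deg L x) * (A⁺ * B)
            ≡⟨ cong (G (suc (deg L x)) * G (deg L x) *_) (transfer v L X) ⟩
          G (suc (deg L x)) * G (deg L x) * (A * B⁺)
            ≡⟨ solve 4 (λ g a h b → g :* h :* (a :* b) := h :* a :* (g :* b)) Eq.refl
                 (G (suc (deg L x))) A (G (deg L x)) B⁺ ⟩
          G (deg L x) * A * (G (suc (deg L x)) * B⁺) ∎)
        split false e = subst Goal (Eq.sym (neighbours-∷-nonadj X e)) (begin
          G (deg (v ∷ L) x) * A⁺ * B
            ≡⟨ cong (λ z → G z * A⁺ * B) (cong length (neighbours-∷-nonadj L (Eq.trans (symm Γ x v) e))) ⟩
          G (deg L x) * A⁺ * B      ≡⟨ *-assoc (G (deg L x)) A⁺ B ⟩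
          G (deg L x) * (A⁺ * B)    ≡⟨ cong (G (deg L x) *_) (transfer v L X) ⟩
          G (deg L x) * (A * B⁺)    ≡⟨ *-assoc (G (deg L x)) A B⁺ ⟨
          G (deg L x) * A * B⁺      ∎)

      count-bound : ∀ L W → L ++ W ↭ allFin n →
        count L * D ^ length L ≤ product (map (λ w → G (deg L w)) L)
      count-bound [] W p = ≤-trans (≤-reflexive (*-identityʳ (count []))) (count-[] allEdges)
        where
        count-[] : ∀ es → forests es (wired []) ≤ 1
        count-[] []             = ≤-refl
        count-[] ((x , y) ∷ es) = ≤-trans
          (≤-reflexive (cong (forests es (wired []) +_) (through-loop (wired []) {x} {y} es (const-zero x y))))
          (≤-trans (≤-reflexive (+-identityʳ _)) (count-[] es))
          where
          const-zero : ∀ x y → wired [] x ≡ wired [] y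
          const-zero zero    zero    = Eq.refl
          const-zero zero    (suc _) = Eq.refl
          const-zero (suc _) zero    = Eq.refl
          const-zero (suc _) (suc _) = Eq.refl
      count-bound (v ∷ L) W p =
        *-cancelʳ-≤ _ _ Π ⦃ >-nonZero Π>0 ⦄ (*-cancelˡ-≤ a (begin
          a * (count (v ∷ L) * (D * D ^ length L) * Π)
            ≡⟨ solve 5 (λ a n d m p → a :* (n :* (d :* m) :* p) := n :* (a :* d :* p) :* m)
                 Eq.refl a (count (v ∷ L)) D (D ^ length L) Π ⟩
          count (v ∷ L) * (a * D * Π) * D ^ length L
            ≡⟨ cong (λ z → count (v ∷ L) * (z * Π) * D ^ length L) G-zero ⟨
          count (v ∷ L) * (G 0 * Π) * D ^ length L
            ≤⟨ *-monoˡ-≤ (D ^ length L) charged ⟩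
          a * count L * (G (deg L v) * Π⁺) * D ^ length L
            ≡⟨ solve 5 (λ a n g p m → a :* n :* (g :* p) :* m := a :* (n :* m :* (g :* p)))
                 Eq.refl a (count L) (G (deg L v)) Π⁺ (D ^ length L) ⟩
          a * (count L * D ^ length L * (G (deg L v) * Π⁺))
            ≤⟨ *-monoʳ-≤ a (*-monoˡ-≤ (G (deg L v) * Π⁺) (count-bound L (v ∷ W) p′)) ⟩
          a * (P * (G (deg L v) * Π⁺))
            ≡⟨ solve 4 (λ a p g q → a :* (p :* (g :* q)) := a :* (g :* (p :* q))) Eq.refl a P (G (deg L v)) Π⁺ ⟩
          a * (G (deg L v) * (P * Π⁺))
            ≡⟨ cong (λ z → a * (G (deg L v) * z)) (transfer v L L) ⟨
          a * (G (deg L v) * (P⁺ * Π))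
            ≡⟨ cong (a *_) (*-assoc (G (deg L v)) P⁺ Π) ⟨
          a * (G (deg L v) * P⁺ * Π)
            ≡⟨ cong (λ z → a * (G z * P⁺ * Π)) (deg-∷-self v L) ⟨
          a * (G (deg (v ∷ L) v) * P⁺ * Π) ∎))
        where
        open ≤-Reasoning
        us = neighbours v L
        Π Π⁺ P P⁺ : ℕ
        Π = product (map (λ u → G (deg L u)) us)
        Π⁺ = product (map (λ u → G (suc (deg L u))) us)
        P = product (map (λ w → G (deg L w)) L)
        P⁺ = product (map (λ w → G (deg (v ∷ L) w)) L)
        p′ : L ++ v ∷ W ↭ allFin n
        p′ = ↭-trans (shift v L W) p
        adjacent : All (λ u → u ∈ L × adj Γ v u ≡ true) us
        adjacent = All.tabulate λ m → ∈-filter⁻ (λ u → adj Γ v u ≟ᵇ true) m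
        Π>0 : 0 < Π
        Π>0 = positive us adjacent
          where
          positive : ∀ us → All (λ u → u ∈ L × adj Γ v u ≡ true) us →
            0 < product (map (λ u → G (deg L u)) us)
          positive []       []              = s≤s z≤n
          positive (u ∷ us) ((_ , e) ∷ es) =
            *-mono-< (G>0 (<⇒≤ (deg-< L W p e))) (positive us es)
        k≤d : deg L v ≤ d
        k≤d = ≤-trans (m≤m+n (deg L v) (deg W v)) (≤-reflexive (Eq.trans (Eq.sym (deg-++ L W v))
          (Eq.trans (Eq.sym (deg-∷-self v (L ++ W))) (Eq.trans (deg-↭ p v) (regular v)))))
        neighbour-bound : ∀ {u} → u ∈ L × adj Γ v u ≡ true →
          deg L u < d × a * count L + 2 * deg L u * countWiring L u ≤ a * a * countWiring L u
        neighbour-bound {u} (u∈ , e) with ∈⇒↭ u∈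
        ... | L′ , q = deg-< L W p e , (begin
          a * count L + 2 * deg L u * countWiring L u
            ≡⟨ cong₂ (λ x y → a * x + 2 * y * countWiring L u) L≡ deg≡ ⟩
          a * count (u ∷ L′) + 2 * deg L′ u * countWiring L u
            ≡⟨ cong (λ z → a * count (u ∷ L′) + 2 * deg L′ u * z) (countWiring-∷ q u∉) ⟩
          a * count (u ∷ L′) + 2 * deg L′ u * count L′
            ≤⟨ wire-degree u L′ (v ∷ W) pu ⟩
          a * a * count L′                ≡⟨ cong (a * a *_) (countWiring-∷ q u∉) ⟨
          a * a * countWiring L u         ∎)
          where
          pu : u ∷ L′ ++ v ∷ W ↭ allFin n
          pu = ↭-trans (++⁺ʳ (v ∷ W) (↭-sym q)) p′
          u∉ : u ∉ L′
          u∉ m = head-∉ pu (∈-++⁺ˡ m)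
          L≡ : count L ≡ count (u ∷ L′)
          L≡ = count-⊆ (∈-resp-↭ q) (∈-resp-↭ (↭-sym q))
          deg≡ : deg L u ≡ deg L′ u
          deg≡ = Eq.trans (deg-↭ q u) (deg-∷-self u L′)
        -- The telescoping starts at m = 0 with X = a N(S + v), matching `G 0`, which is a D.
        charged : count (v ∷ L) * (G 0 * Π) ≤ a * count L * (G (deg L v) * Π⁺)
        charged = charge-neighbours profile (count (v ∷ L)) (count L) (countWiring L) (deg L) us 0
          (a * count L) k≤d (wire v L W p)
          (≤-reflexive (Eq.trans (+-identityʳ _) (Eq.sym (*-assoc a a (count L)))))
          (All.map neighbour-bound adjacent)

      count-all : count (allFin n) ≤ d ^ n
      count-all = *-cancelʳ-≤ _ _ (D ^ n) ⦃ m^n≢0 D n ⦃ >-nonZero D>0 ⦄ ⦄ (begin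
        count (allFin n) * D ^ n
          ≡⟨ cong (λ z → count (allFin n) * D ^ z) (length-tabulate {n = n} (λ i → i)) ⟨
        count (allFin n) * D ^ length (allFin n)
          ≤⟨ count-bound (allFin n) [] (↭-reflexive (++-identityʳ (allFin n))) ⟩
        product (map (λ w → G (deg (allFin n) w)) (allFin n))  ≡⟨ powers (allFin n) ⟩
        (d * D) ^ length (allFin n)
          ≡⟨ cong ((d * D) ^_) (length-tabulate {n = n} (λ i → i)) ⟩
        (d * D) ^ n                                            ≡⟨ ^-distribʳ-* n d D ⟩
        d ^ n * D ^ n ∎)
        where
        open ≤-Reasoning
        powers : ∀ L → product (map (λ w → G (deg (allFin n) w)) L) ≡ (d * D) ^ length L
        powers []      = Eq.refl
        powers (w ∷ L) = cong₂ _*_ (Eq.trans (cong G (regular w)) G-top) (powers L)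

    -- Both sides are squared so that the number of edges enters doubled, as d n; the claim becomes
    -- 2^d ≤ d², true for d = 2, 3, 4.
    count-small : d ≤ 4 → 2 ≤ d → count (allFin n) ≤ d ^ n
    count-small d≤4 2≤d = square-cancel (begin
      count (allFin n) * count (allFin n)
        ≤⟨ *-mono-≤ (forests-≤-2^ allEdges _) (forests-≤-2^ allEdges _) ⟩
      2 ^ length allEdges * 2 ^ length allEdges   ≡⟨ ^-distribˡ-+-* 2 (length allEdges) (length allEdges) ⟨
      2 ^ (length allEdges + length allEdges)     ≡⟨ cong (2 ^_) (handshake (allFin n)) ⟩
      2 ^ sum (map (deg (allFin n)) (allFin n))   ≡⟨ cong (2 ^_) (sums (allFin n)) ⟩
      2 ^ (d * length (allFin n))
        ≡⟨ cong (λ z → 2 ^ (d * z)) (length-tabulate {n = n} (λ i → i)) ⟩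
      2 ^ (d * n)                                 ≡⟨ ^-*-assoc 2 d n ⟨
      (2 ^ d) ^ n                                 ≤⟨ ^-monoˡ-≤ n (2^d≤d² d 2≤d d≤4) ⟩
      (d * d) ^ n                                 ≡⟨ ^-distribʳ-* n d d ⟩
      d ^ n * d ^ n                               ∎)
      where
      open ≤-Reasoning
      square-cancel : ∀ {x y} → x * x ≤ y * y → x ≤ y
      square-cancel {x} {y} q with x ≤? y
      ... | yes x≤y = x≤y
      ... | no x≰y  = ⊥-elim (<⇒≱ (*-mono-< (≰⇒> x≰y) (≰⇒> x≰y)) q)
      2^d≤d² : ∀ d → 2 ≤ d → d ≤ 4 → 2 ^ d ≤ d * d
      2^d≤d² 1 (s≤s ()) _
      2^d≤d² 2 _ _ = from-yes (4 ≤? 4)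
      2^d≤d² 3 _ _ = from-yes (8 ≤? 9)
      2^d≤d² 4 _ _ = from-yes (16 ≤? 16)
      2^d≤d² (suc (suc (suc (suc (suc _))))) _ (s≤s (s≤s (s≤s (s≤s ()))))
      sums : ∀ L → sum (map (deg (allFin n)) L) ≡ d * length L
      sums []      = Eq.sym (*-zeroʳ d)
      sums (w ∷ L) = Eq.trans (cong₂ _+_ (regular w) (sums L)) (Eq.sym (*-suc d (length L)))

-- Acyclic edge sets

-- The branch of deletion and contraction prescribed by `A` never contracts a loop.
Independent : List (Edge n) → Labelling n → (Edge n → Bool) → Set
Independent []             π A = ⊤
Independent ((x , y) ∷ es) π A =
  if A (x , y) then π x ≢ π y × Independent es (merge π x y) A else Independent es π A

module _ {I : Set} (A : I → Edge n → Bool) where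

  length-split : ∀ e (is : List I) → length is ≡
    length (filter (λ i → A i e ≟ᵇ false) is) + length (filter (λ i → A i e ≟ᵇ true) is)
  length-split e []       = Eq.refl
  length-split e (i ∷ is) with A i e
  ... | true  = Eq.trans (cong suc (length-split e is)) (Eq.sym (+-suc _ _))
  ... | false = cong suc (length-split e is)

  -- Members that agree on the first edge still differ on the later ones, so both halves of the
  -- family satisfy the hypotheses again; if that edge is a loop, no member uses it.
  family-bound : ∀ es (π : Labelling n) (is : List I) → Unique is →
    All (λ i → Independent es π (A i)) is →
    (∀ {i j} → i ∈ is → j ∈ is → (∀ {e} → e ∈ es → A i e ≡ A j e) → i ≡ j) →
    length is ≤ forests es π
  family-bound [] π []           _                _ _        = z≤n
  family-bound [] π (i ∷ [])     _                _ _        = ≤-refl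
  family-bound [] π (i ∷ j ∷ is) ((i≢j ∷ _) ∷ _) _ distinct =
    ⊥-elim (i≢j (distinct (here Eq.refl) (there (here Eq.refl)) λ ()))
  family-bound (e@(x , y) ∷ es) π is unique indep distinct = begin
    length is                  ≡⟨ length-split e is ⟩
    length outs + length ins   ≤⟨ +-mono-≤ outs-bound (ins-bound (π x ≟ π y)) ⟩
    forests es π + through es e π ∎
    where
    open ≤-Reasoning
    without? = λ i → A i e ≟ᵇ false
    with? = λ i → A i e ≟ᵇ true
    outs = filter without? is
    ins = filter with? is
    distinct′ : ∀ b {i j} → i ∈ filter (λ i → A i e ≟ᵇ b) is → j ∈ filter (λ i → A i e ≟ᵇ b) is →
      (∀ {f} → f ∈ es → A i f ≡ A j f) → i ≡ j
    distinct′ b {i} {j} i∈ j∈ same with ∈-filter⁻ (λ i → A i e ≟ᵇ b) i∈ | ∈-filter⁻ (λ i → A i e ≟ᵇ b) j∈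
    ... | i∈is , p | j∈is , q = distinct i∈is j∈is same′
      where
      same′ : ∀ {f} → f ∈ e ∷ es → A i f ≡ A j f
      same′ (here Eq.refl) = Eq.trans p (Eq.sym q)
      same′ (there f∈)     = same f∈
    outs-bound : length outs ≤ forests es π
    outs-bound = family-bound es π outs (unique-filter⁺ without? unique) indep′ (distinct′ false)
      where
      indep′ : All (λ i → Independent es π (A i)) outs
      indep′ = All.tabulate λ {i} i∈ → case ∈-filter⁻ without? i∈ of λ where
        (i∈is , p) → subst (λ b → if b then π x ≢ π y × Independent es (merge π x y) (A i)
          else Independent es π (A i)) p (All.lookup indep i∈is)
    used : ∀ {i} → i ∈ ins → π x ≢ π y × Independent es (merge π x y) (A i)
    used {i} i∈ with ∈-filter⁻ with? i∈
    ... | i∈is , p = subst (λ b → if b then π x ≢ π y × Independent es (merge π x y) (A i)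
      else Independent es π (A i)) p (All.lookup indep i∈is)
    ins-bound : Dec (π x ≡ π y) → length ins ≤ through es e π
    ins-bound (no ¬l) = ≤-trans
      (family-bound es (merge π x y) ins (unique-filter⁺ with? unique)
        (All.tabulate (proj₂ ∘ used)) (distinct′ true))
      (≤-reflexive (Eq.sym (through-nonloop π es ¬l)))
    ins-bound (yes l) = ≤-trans (≤-reflexive (empty ins λ i∈ → proj₁ (used i∈) l)) z≤n
      where
      empty : ∀ (js : List I) → (∀ {i} → i ∈ js → ⊥) → length js ≡ 0
      empty []      _ = Eq.refl
      empty (j ∷ _) h = ⊥-elim (h (here Eq.refl))

lookup-injective : {A : Set} {xs : List A} → Unique xs → ∀ i j → lookup xs i ≡ lookup xs j → i ≡ j
lookup-injective (_ ∷ _)   zero    zero    _ = Eq.refl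
lookup-injective (x# ∷ _)  zero    (suc j) e = ⊥-elim (All.lookup x# (∈-lookup j) e)
lookup-injective (x# ∷ _)  (suc i) zero    e = ⊥-elim (All.lookup x# (∈-lookup i) (Eq.sym e))
lookup-injective (_ ∷ uxs) (suc i) (suc j) e = cong suc (lookup-injective uxs i j e)

-- From walks to paths and cycles.

module _ {n : ℕ} (R : Fin n → Fin n → Set) where

  data Path : Fin n → Fin n → List (Fin n) → Set where
    stop : ∀ {x} → Path x x (x ∷ [])
    step : ∀ {x z y p} → R x z → Path z y p → x ∉ p → Path x y (x ∷ p)

module _ {n : ℕ} {R : Fin n → Fin n → Set} where

  open import Data.List.Membership.DecPropositional (_≟_ {n}) using (_∈?_)

  suffix : ∀ {x y z p} → z ∈ p → Path R x y p → ∃ (Path R z y)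
  suffix (here Eq.refl) stop           = _ , stop
  suffix (here Eq.refl) (step r P x∉) = _ , step r P x∉
  suffix (there z∈)     (step r P x∉) = suffix z∈ P

  walk⇒path : ∀ {x y} → Walk R x y → ∃ (Path R x y)
  walk⇒path ε       = _ , stop
  walk⇒path {x} (r ◅ w) with walk⇒path w
  ... | p , P with x ∈? p
  ...   | yes x∈ = suffix x∈ P
  ...   | no x∉  = x ∷ p , step r P x∉

  path-unique : ∀ {x y p} → Path R x y p → Unique p
  path-unique stop          = [] ∷ []
  path-unique (step r P x∉) = All.¬Any⇒All¬ _ x∉ ∷ path-unique P

  path-head : ∀ {x y p} → Path R x y p → ∃ λ q → p ≡ x ∷ q
  path-head stop          = _ , Eq.refl
  path-head (step _ _ _)  = _ , Eq.refl

  path-step : ∀ {x y w q} → Path R x y (w ∷ q) → (i : Fin (length q)) →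
    R (lookup (w ∷ q) (inject₁ i)) (lookup q i)
  path-step (step r P x∉) i with path-head P
  path-step (step r P x∉) zero    | _ , Eq.refl = r
  path-step (step r P x∉) (suc i) | _ , Eq.refl = path-step P i

  path-last : ∀ {x y w q} → Path R x y (w ∷ q) → lookup (w ∷ q) (fromℕ (length q)) ≡ y
  path-last stop = Eq.refl
  path-last (step r P x∉) with path-head P
  ... | _ , Eq.refl = path-last P

module _ {n : ℕ} {Γ : SimpleGraph n} where

  open GraphCounts Γ

  -- The conditions `x ≢ y` and `¬ R x y` exclude paths on one or two vertices, so closing the path
  -- gives a cycle of length at least three.
  path⇒cycle : (A : EdgeSet Γ) {R : Fin n → Fin n → Set} → (∀ {u w} → R u w → mem A u w ≡ true) →
    ∀ {x y p} → Path R x y p → x ≢ y → ¬ R x y → mem A x y ≡ true → Cycle A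
  path⇒cycle A R⇒mem stop x≢x _ _ = ⊥-elim (x≢x Eq.refl)
  path⇒cycle A R⇒mem (step r stop _) _ ¬R _ = ⊥-elim (¬R r)
  path⇒cycle A R⇒mem P@(step {x} r (step {z} {w} r′ P″ _) _) _ _ xy with path-head P″
  ... | q , Eq.refl = record
    { m     = length q
    ; v     = lookup (x ∷ z ∷ w ∷ q)
    ; v-inj = λ {i} {j} → lookup-injective (path-unique P) i j
    ; step  = λ i → R⇒mem (path-step P i)
    ; close = subst (λ u → mem A u x ≡ true) (Eq.sym (path-last P)) (Eq.trans (msymm A _ _) xy)
    }

  selected : EdgeSet Γ → Edge (suc n) → Bool
  selected A (suc x , suc y) = mem A x y
  selected A (zero  , _)     = false
  selected A (suc _ , zero)  = false

  -- The reversed pair is excluded too: edge sets are symmetric, and an edge already processed must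
  -- not return in the other orientation.
  Distinct : Edge (suc n) → Edge (suc n) → Set
  Distinct e f = e ≢ f × e ≢ (proj₂ f , proj₁ f)

  InGraph : Edge (suc n) → Set
  InGraph e = ∃₂ λ x y → e ≡ (suc x , suc y) × adj Γ x y ≡ true

  edges-inGraph : ∀ L → All InGraph (edges L)
  edges-inGraph []      = []
  edges-inGraph (v ∷ L) = All.++⁺
    (All.map⁺ (All.map⁺ (All.tabulate λ {u} m →
      v , u , Eq.refl , proj₂ (∈-filter⁻ (λ u → adj Γ v u ≟ᵇ true) {xs = L} m))))
    (edges-inGraph L)

  edges-distinct : ∀ {L} → Unique L → AllPairs Distinct (edges L)
  edges-distinct {[]}    []             = []
  edges-distinct {v ∷ L} (v# ∷ unique) = AllPairs.++⁺
    (AllPairs.map⁺ (AllPairs.map⁺ (star-distinct (neighbours v L) (neighbours-⊆ v L)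
      (unique-filter⁺ (λ u → adj Γ v u ≟ᵇ true) unique))))
    (edges-distinct unique)
    (All.map⁺ (All.map⁺ (All.tabulate λ {u} _ → All.map
      (λ { (x≢ , y≢) → (λ { Eq.refl → x≢ Eq.refl }) , (λ { Eq.refl → y≢ Eq.refl }) })
      (edges-avoid L v∉))))
    where
    v∉ : v ∉ L
    v∉ = All.All¬⇒¬Any v#
    star-distinct : ∀ us → All (_∈ L) us → Unique us →
      AllPairs (λ u w → Distinct (suc v , suc u) (suc v , suc w)) us
    star-distinct []       _           _           = []
    star-distinct (u ∷ us) (u∈ ∷ us∈) (u# ∷ uniq) =
      All.map (λ u≢w → (λ { Eq.refl → u≢w Eq.refl }) , (λ { Eq.refl → v∉ u∈ })) u#
        ∷ star-distinct us us∈ uniq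

  adj⇒∈edges : ∀ {v w} L → v ∈ L → w ∈ L → adj Γ v w ≡ true →
    (suc v , suc w) ∈ edges L ⊎ (suc w , suc v) ∈ edges L
  adj⇒∈edges {v} (_ ∷ L) (here Eq.refl) (here Eq.refl) e with () ← Eq.trans (Eq.sym e) (irrefl Γ v)
  adj⇒∈edges {v} (_ ∷ L) (here Eq.refl) (there w∈) e =
    inj₁ (∈-++⁺ˡ (∈-map⁺ (suc v ,_) (∈-map⁺ suc (∈-filter⁺ (λ u → adj Γ v u ≟ᵇ true) w∈ e))))
  adj⇒∈edges {v} {w} (_ ∷ L) (there v∈) (here Eq.refl) e =
    inj₂ (∈-++⁺ˡ (∈-map⁺ (suc w ,_) (∈-map⁺ suc
      (∈-filter⁺ (λ u → adj Γ w u ≟ᵇ true) v∈ (Eq.trans (symm Γ w v) e)))))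
  adj⇒∈edges (z ∷ L) (there v∈) (there w∈) e with adj⇒∈edges L v∈ w∈ e
  ... | inj₁ m = inj₁ (∈-++⁺ʳ (star (suc z) (map suc (neighbours z L))) m)
  ... | inj₂ m = inj₂ (∈-++⁺ʳ (star (suc z) (map suc (neighbours z L))) m)

  module _ (A : EdgeSet Γ) (acyclic : Acyclic A) where

    -- Here es is the list of edges still to be processed.
    Used : List (Edge (suc n)) → Fin n → Fin n → Set
    Used es x y = mem A x y ≡ true × (suc x , suc y) ∉ es × (suc y , suc x) ∉ es

    used-tail : ∀ {e es x y} → Used (e ∷ es) x y → Used es x y
    used-tail (m , p , q) = m , p ∘ there , q ∘ there

    -- The invariant is that vertices with equal labels are joined by a walk of processed edges of
    -- `A`. A loop of `A` met next would have its ends joined without itself, which closes a cycle.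
    acyclic⇒independent : ∀ es π → All InGraph es → AllPairs Distinct es →
      (∀ {x y} → π (suc x) ≡ π (suc y) → Walk (Used es) x y) → Independent es π (selected A)
    acyclic⇒independent []       π _ _ _ = tt
    acyclic⇒independent (e ∷ es) π ((x , y , Eq.refl , xy) ∷ inG) (e# ∷ distinct) walk
      with mem A x y in m
    ... | false = acyclic⇒independent es π inG distinct (Walk.map used-tail ∘ walk)
    ... | true  = nonloop , acyclic⇒independent es (merge π (suc x) (suc y)) inG distinct walk′
      where
      x≢y : x ≢ y
      x≢y Eq.refl with () ← Eq.trans (Eq.sym xy) (irrefl Γ x)
      nonloop : π (suc x) ≢ π (suc y)
      nonloop l = acyclic (path⇒cycle A proj₁ (proj₂ (walk⇒path (walk l))) x≢y
        (λ { (_ , p , _) → p (here Eq.refl) }) m)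
      xy∉ : (suc x , suc y) ∉ es
      xy∉ i = proj₁ (All.lookup e# i) Eq.refl
      yx∉ : (suc y , suc x) ∉ es
      yx∉ i = proj₂ (All.lookup e# i) Eq.refl
      walk′ : ∀ {u w} → merge π (suc x) (suc y) (suc u) ≡ merge π (suc x) (suc y) (suc w) →
        Walk (Used es) u w
      walk′ {u} {w} l with merge-related π (suc x) (suc y) {suc u} {suc w} l
      ... | inj₁ p              = Walk.map used-tail (walk p)
      ... | inj₂ (inj₁ (p , q)) =
        Walk.map used-tail (walk p) ◅◅ (m , xy∉ , yx∉) ◅ Walk.map used-tail (walk (Eq.sym q))
      ... | inj₂ (inj₂ (p , q)) =
        Walk.map used-tail (walk p) ◅◅ (Eq.trans (msymm A y x) m , yx∉ , xy∉)
          ◅ Walk.map used-tail (walk (Eq.sym q))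

  agree⇒same : (A B : EdgeSet Γ) → (∀ {e} → e ∈ allEdges → selected A e ≡ selected B e) → SameEdges A B
  agree⇒same A B agree x y with adj Γ x y in e
  ... | true with adj⇒∈edges (allFin n) (∈-allFin x) (∈-allFin y) e
  ...   | inj₁ i = agree i
  ...   | inj₂ i = Eq.trans (msymm A x y) (Eq.trans (agree i) (msymm B y x))
  agree⇒same A B agree x y | false = Eq.trans (absent A) (Eq.sym (absent B))
    where
    absent : (C : EdgeSet Γ) → mem C x y ≡ false
    absent C with mem C x y in m
    ... | false = Eq.refl
    ... | true with () ← Eq.trans (Eq.sym e) (sub C x y m)

  family≤count : FCountAtMost Γ (count (allFin n))
  family≤count k f distinct = begin
    k                  ≡⟨ length-tabulate {n = k} (λ i → i) ⟨
    length (allFin k)  ≤⟨ family-bound (λ i → selected (proj₁ (f i))) allEdges (wired (allFin n)) (allFin k)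
                            (allFin⁺ k) (All.tabulate λ {i} _ → independent i)
                            (λ {i} {j} _ _ agree → distinct i j (agree⇒same (proj₁ (f i)) (proj₁ (f j)) agree)) ⟩
    count (allFin n)   ∎
    where
    open ≤-Reasoning
    independent : ∀ i → Independent allEdges (wired (allFin n)) (selected (proj₁ (f i)))
    independent i = acyclic⇒independent (proj₁ (f i)) (proj₂ (f i)) allEdges (wired (allFin n))
      (edges-inGraph (allFin n)) (edges-distinct (allFin⁺ n)) initial
      where
      -- Nothing is wired at the start, so equal labels mean equal vertices and the empty walk
      -- suffices.
      initial : ∀ {x y} → wired (allFin n) (suc x) ≡ wired (allFin n) (suc y) →
        Walk (Used (proj₁ (f i)) (proj₂ (f i)) allEdges) x y
      initial {x} {y} l with suc-injective (wired-fixes (∈-allFin y) (suc x) l)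
      ... | Eq.refl = ε

theorem1p4 : (d n : ℕ) → 2 ≤ d → (G : SimpleGraph n) → Regular d G →
    FCountAtMost G (d ^ n)
theorem1p4 d n 2≤d G regular k f distinct = ≤-trans (family≤count k f distinct) count≤
  where
  open GraphCounts G
  open Bounds regular
  count≤ : count (allFin n) ≤ d ^ n
  count≤ with 5 ≤? d
  ... | yes 5≤d = count-all (profile 5≤d)
  ... | no 5≰d  = count-small (≤-pred (≰⇒> 5≰d)) 2≤d
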